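{- Let $n$ be a positive integer and let $s$ and $\mathbf x=(x_1,\ldots,x_n)$ be variables. For $0\le p\le n$ let $CTV_p(s,\mathbf x)$ and $CTB_p(s,\mathbf x)$ be the constant terms of the Laurent series in $t$ at $t=0$ of $$V_p(s,\mathbf x)(t)=\sum_{|J|=p}\frac{e^{ts}}{\prod_{a\in J}(-t x_a)},\qquad B_p(s,\mathbf x)(t)=\sum_{|J|=p}\frac{e^{ts}}{\prod_{a\in J}(1-e^{t x_a})},$$ respectively, where $J$ runs over the subsets of $\{1,\ldots,n\}$ of cardinality $p$. Then the following identities of meromorphic functions of $(s,x_1,\ldots,x_n)$ hold. If $n$ is odd and $m=(n+1)/2$, then $$\sum_{p=0}^n(-1)^{n-p}(p+1)!\,CTV_p(s,\mathbf x)=\sum_{p=m}^n(-1)^p\sum_{i=1}^{p+1-m}(-1)^{m-i}\binom{p+1}{m+i}\,2\,i\,CTB_p(-is,\mathbf x).$$ If $n$ is even and $m=n/2$, then $$\sum_{p=0}^n(-1)^{n-p}(p+1)!\,CTV_p(s,\mathbf x)=\sum_{p=m}^n(-1)^p\sum_{i=1}^{p+1-m}(-1)^{m+1-i}\left(\binom{p+1}{m+i}-\binom{p+1}{m+i+1}\right) i\,CTB_p(-is,\mathbf x).$$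
   Context: The constant term of a Laurent series in $t$ is its coefficient of $t^0$. $CTB_p(-is,\mathbf x)$ means $CTB_p$ with $s$ replaced by $-is$, where $i$ is the integer summation index (not the imaginary unit). For $p=0$ the only subset is $J=\emptyset$ and the empty product is $1$, so $V_0(s,\mathbf x)(t)=B_0(s,\mathbf x)(t)=e^{ts}$. $\binom{a}{b}=0$ when $b>a\ge 0$. -}

module Defs where

open import Algebra.Apartness.Bundles using (HeytingField; HeytingCommutativeRing)
open import Algebra.Bundles using (CommutativeRing)
open import Data.Fin.Base using (Fin; toℕ; fromℕ<; punchIn)
import Data.Fin.Properties as Fin
open import Data.Fin.Subset using (Subset; inside; outside; ∣_∣)
open import Data.Fin.Subset.Properties using (_∈?_)
open import Data.List.Base using (List; []; _∷_; _++_; map; filter; foldr; allFin)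
open import Data.Nat.Base as ℕ using (ℕ; zero; suc; NonZero; _!; _∸_)
import Data.Nat.Properties as ℕ
open import Data.Product.Base using (proj₁; proj₂; _,_)
import Data.Vec.Base as Vec
open import Data.Vec.Functional using (Vector; removeAt)
import Level
open import Relation.Binary.PropositionalEquality using (_≡_; _≢_)
import Relation.Binary.PropositionalEquality as ≡
open import Relation.Nullary.Decidable.Core using (yes; no)
open import Relation.Nullary.Negation using (contradiction)

subsets : ∀ n → List (Subset n)
subsets zero    = Vec.[] ∷ []
subsets (suc n) = map (outside Vec.∷_) (subsets n) ++ map (inside Vec.∷_) (subsets n)

subsetsOfSize : ∀ n → ℕ → List (Subset n)
subsetsOfSize n p = filter (λ J → ∣ J ∣ ℕ.≟ p) (subsets n)

elements : ∀ {n} → Subset n → List (Fin n)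
elements J = filter (_∈? J) (allFin _)

module _ {c ℓ₁ ℓ₂} (K : HeytingField c ℓ₁ ℓ₂) where

  open HeytingField K using (Carrier; _#_; 0#; 1#; heytingCommutativeRing)
  open CommutativeRing (HeytingCommutativeRing.commutativeRing heytingCommutativeRing)
    using (semiring)
  open import Algebra.Properties.Semiring.Mult semiring using (_×_)

  CharacteristicZero : Set ℓ₂
  CharacteristicZero = ∀ k .{{_ : NonZero k}} → (k × 1#) # 0#

module Field {c ℓ₁ ℓ₂} (K : HeytingField c ℓ₁ ℓ₂) where

  open HeytingField K using (_#_; heytingCommutativeRing; #⇒invertible) public
  open CommutativeRing (HeytingCommutativeRing.commutativeRing heytingCommutativeRing) public
  open import Algebra.Apartness.Properties.HeytingCommutativeRing heytingCommutativeRing public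
  open import Algebra.Properties.Ring ring public
    using (-0#≈0#; -‿distribˡ-*; -1*x≈-x)
  open import Algebra.Properties.Semiring.Mult semiring public using (_×_)
  open import Algebra.Properties.Semiring.Exp semiring public using (_^_)
  open import Algebra.Properties.CommutativeMonoid.Sum +-commutativeMonoid public
    using (sum; sum-cong-≋; sum-replicate-zero; sum-remove)
  open import Relation.Binary.Reasoning.Setoid setoid

  -- `#⇒invertible` inverts x - 0#, which is x only up to ≈.
  recip : ∀ x → x # 0# → Carrier
  recip x x#0 = proj₁ (#⇒invertible x#0)

  recip-inverseʳ : ∀ x (x#0 : x # 0#) → x * recip x x#0 ≈ 1#
  recip-inverseʳ x x#0 = begin
    x * recip x x#0         ≈⟨ *-congʳ (x-0≈x x) ⟨
    (x - 0#) * recip x x#0  ≈⟨ proj₂ (proj₂ (#⇒invertible x#0)) ⟩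
    1#                      ∎

  recip#0 : ∀ x (x#0 : x # 0#) → recip x x#0 # 0#
  recip#0 x x#0 = invertibleˡ⇒# (x , trans (*-congˡ (x-0≈x _)) (recip-inverseʳ x x#0))

  -x#0 : ∀ {x} → x # 0# → (- x) # 0#
  -x#0 {x} x#0 = #-congʳ (-1*x≈-x x) (x#0y#0→xy#0 (invertibleˡ⇒# (- 1# , eq)) x#0)
    where
    eq : - 1# * (- 1# - 0#) ≈ 1#
    eq = begin
      - 1# * (- 1# - 0#)  ≈⟨ *-congˡ (x-0≈x (- 1#)) ⟩
      - 1# * - 1#         ≈⟨ -1*x≈-x (- 1#) ⟩
      - (- 1#)            ≈⟨ -‿involutive 1# ⟩
      1#                  ∎
      where open import Algebra.Properties.Ring ring using (-‿involutive)

  -- The sum of f i over a ≤ i ≤ b, empty when a > b.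
  rangeSum : ℕ → ℕ → (ℕ → Carrier) → Carrier
  rangeSum a b f = sum {suc b ∸ a} (λ j → f (a ℕ.+ toℕ j))

  infixl 10 rangeSum
  syntax rangeSum a b (λ i → e) = ∑[ a ≤ i ≤ b ] e

  sum-zero : ∀ {n} (f : Vector Carrier n) → (∀ j → f j ≈ 0#) → sum f ≈ 0#
  sum-zero {n} f f≈0 = trans (sum-cong-≋ f≈0) (sum-replicate-zero n)

  sum-single : ∀ {n} (f : Vector Carrier n) i → (∀ j → j ≢ i → f j ≈ 0#) → sum f ≈ f i
  sum-single {suc n} f i f≈0 = begin
    sum f                     ≈⟨ sum-remove {i = i} f ⟩
    f i + sum (removeAt f i)  ≈⟨ +-congˡ (sum-zero (removeAt f i) λ j → f≈0 (punchIn i j) (Fin.punchInᵢ≢i i j)) ⟩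
    f i + 0#                  ≈⟨ +-identityʳ (f i) ⟩
    f i                       ∎

  Series : Set c
  Series = ℕ → Carrier

  delay : ℕ → Series → Series
  delay zero    f k       = f k
  delay (suc d) f zero    = 0#
  delay (suc d) f (suc k) = delay d f k

  convolve : Series → Series → Series
  convolve f g k = ∑[ 0 ≤ j ≤ k ] (f j * g (k ∸ j))

  -- Given u₀ r = 1, the coefficients v₀, v₁, … of 1/u satisfy v₀ = r and
  -- v_{k+1} = - r (u₁ v_k + u₂ v_{k-1} + … + u_{k+1} v₀).
  -- `reciprocals u r k` is the vector v_k , v_{k-1} , … , v₀.
  reciprocals : Series → Carrier → ∀ k → Vec.Vec Carrier (suc k)
  reciprocals u r zero    = r Vec.∷ Vec.[]
  reciprocals u r (suc k) =
    (- (r * sum (λ j → u (suc (toℕ j)) * Vec.lookup vs j))) Vec.∷ vs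
    where vs = reciprocals u r k

  reciprocal : Series → Carrier → Series
  reciprocal u r k = Vec.head (reciprocals u r k)

  -- A formal Laurent series in t: (pole , coeff) stands for Σ_k coeff k · t^(k - pole).
  -- `coeff` may start with zeros, so a series has many representations.
  record Laurent : Set c where
    constructor laurent
    field
      pole  : ℕ
      coeff : Series

  open Laurent public

  constantTerm : Laurent → Carrier
  constantTerm f = coeff f (pole f)

  monomial : Carrier → ℕ → Laurent
  monomial a d = laurent 0 (delay d λ { zero → a ; (suc _) → 0# })

  0ᴸ 1ᴸ : Laurent
  0ᴸ = monomial 0# 0
  1ᴸ = monomial 1# 0

  infixl 6 _+ᴸ_ _-ᴸ_
  infixl 7 _*ᴸ_
  infix  8 -ᴸ_

  _+ᴸ_ : Laurent → Laurent → Laurent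
  f +ᴸ g = laurent (pole f ℕ.+ pole g)
                   (λ k → delay (pole g) (coeff f) k + delay (pole f) (coeff g) k)

  -ᴸ_ : Laurent → Laurent
  -ᴸ f = laurent (pole f) (λ k → - coeff f k)

  _-ᴸ_ : Laurent → Laurent → Laurent
  f -ᴸ g = f +ᴸ (-ᴸ g)

  _*ᴸ_ : Laurent → Laurent → Laurent
  f *ᴸ g = laurent (pole f ℕ.+ pole g) (convolve (coeff f) (coeff g))

  sumᴸ productᴸ : ∀ {a} {A : Set a} → List A → (A → Laurent) → Laurent
  sumᴸ     xs f = foldr (λ x → f x +ᴸ_) 0ᴸ xs
  productᴸ xs f = foldr (λ x → f x *ᴸ_) 1ᴸ xs

  -- A witness that f is nonzero: the position of its first nonzero coefficient.
  record Leading (f : Laurent) : Set (ℓ₁ Level.⊔ ℓ₂) where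
    constructor leading
    field
      position : ℕ
      below    : ∀ {k} → k ℕ.< position → coeff f k ≈ 0#
      lead#0   : coeff f position # 0#

  open Leading

  -- With u₀ = coeff f position, f = t^(position - pole) u, so 1/f = t^(pole - position) (1/u).
  inverseᴸ : ∀ f → Leading f → Laurent
  inverseᴸ f l = laurent (position l) (delay (pole f) (reciprocal u (recip (u 0) u₀#0)))
    where
    u : Series
    u k = coeff f (k ℕ.+ position l)
    u₀#0 : u 0 # 0#
    u₀#0 = lead#0 l

  divide : Laurent → ∀ g → Leading g → Laurent
  divide f g l = f *ᴸ inverseᴸ g l

  leading-1 : Leading 1ᴸ
  leading-1 = leading 0 (λ ()) 1#0

  leading-* : ∀ {f g} → Leading f → Leading g → Leading (f *ᴸ g)
  leading-* {f} {g} (leading a f<a fa) (leading b g<b gb) = leading (a ℕ.+ b)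
    (λ {k} k<a+b → sum-zero (term k) λ j → vanish k (toℕ j) λ a≤j →
      ℕ.+-cancelˡ-< a _ _ (ℕ.≤-<-trans (ℕ.+-monoˡ-≤ (k ∸ toℕ j) a≤j)
        (≡.subst (ℕ._< a ℕ.+ b) (≡.sym (ℕ.m+[n∸m]≡n (Fin.toℕ≤pred[n] j))) k<a+b)))
    (#-congʳ (sym middle) (x#0y#0→xy#0 fa gb))
    where
    term : ∀ k → Vector Carrier (suc k)
    term k j = coeff f (toℕ j) * coeff g (k ∸ toℕ j)

    vanish : ∀ k j → (a ℕ.≤ j → k ∸ j ℕ.< b) → coeff f j * coeff g (k ∸ j) ≈ 0#
    vanish k j h with a ℕ.≤? j
    ... | yes a≤j = trans (*-congˡ (g<b (h a≤j))) (zeroʳ _)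
    ... | no  a≰j = trans (*-congʳ (f<a (ℕ.≰⇒> a≰j))) (zeroˡ _)

    i : Fin (suc (a ℕ.+ b))
    i = fromℕ< (ℕ.s≤s (ℕ.m≤m+n a b))

    i≡a : toℕ i ≡ a
    i≡a = Fin.toℕ-fromℕ< _

    others : ∀ j → j ≢ i → term (a ℕ.+ b) j ≈ 0#
    others j j≢i = vanish (a ℕ.+ b) (toℕ j) λ a≤j →
      let a<j = ℕ.≤∧≢⇒< a≤j λ a≡j → j≢i (Fin.toℕ-injective (≡.trans (≡.sym a≡j) (≡.sym i≡a)))
      in ≡.subst (a ℕ.+ b ∸ toℕ j ℕ.<_) (ℕ.m+n∸m≡n a b)
           (ℕ.∸-monoʳ-< a<j (Fin.toℕ≤pred[n] j))

    middle : convolve (coeff f) (coeff g) (a ℕ.+ b) ≈ coeff f a * coeff g b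
    middle = begin
      sum (term (a ℕ.+ b))                        ≈⟨ sum-single (term (a ℕ.+ b)) i others ⟩
      coeff f (toℕ i) * coeff g (a ℕ.+ b ∸ toℕ i)  ≡⟨ ≡.cong (λ j → coeff f j * coeff g (a ℕ.+ b ∸ j)) i≡a ⟩
      coeff f a * coeff g (a ℕ.+ b ∸ a)           ≡⟨ ≡.cong (λ j → coeff f a * coeff g j) (ℕ.m+n∸m≡n a b) ⟩
      coeff f a * coeff g b                       ∎

  leading-product : ∀ {a} {A : Set a} (xs : List A) (f : A → Laurent) →
                    (∀ x → Leading (f x)) → Leading (productᴸ xs f)
  leading-product []       f l = leading-1
  leading-product (x ∷ xs) f l = leading-* (l x) (leading-product xs f l)

module Series-in-t {c ℓ₁ ℓ₂} (K : HeytingField c ℓ₁ ℓ₂) (char0 : CharacteristicZero K) where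

  open Field K public
  open import Relation.Binary.Reasoning.Setoid setoid

  1/_! : ℕ → Carrier
  1/ k ! = recip ((k !) × 1#) (char0 (k !) {{k ℕ.!≢0}})

  exp[t_] : Carrier → Laurent
  exp[t y ] = laurent 0 (λ k → y ^ k * 1/ k !)

  -[t_] : Carrier → Laurent
  -[t y ] = monomial (- y) 1

  1-exp[t_] : Carrier → Laurent
  1-exp[t y ] = 1ᴸ -ᴸ exp[t y ]

  leading-monomial : ∀ y → y # 0# → Leading -[t y ]
  leading-monomial y y#0 = leading 1 (λ { {zero} _ → refl ; {suc _} (ℕ.s≤s ()) }) (-x#0 y#0)

  leading-1-exp : ∀ y → y # 0# → Leading 1-exp[t y ]
  leading-1-exp y y#0 = leading 1 (λ { {zero} _ → coeff₀ ; {suc _} (ℕ.s≤s ()) })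
    (#-congʳ (sym (+-identityˡ _)) (-x#0 (x#0y#0→xy#0 y^1#0 (recip#0 _ _))))
    where
    y^1#0 : (y ^ 1) # 0#
    y^1#0 = #-congʳ (sym (*-identityʳ y)) y#0

    1/0!≈1 : 1/ 0 ! ≈ 1#
    1/0!≈1 = begin
      1/ 0 !              ≈⟨ *-identityˡ _ ⟨
      1# * 1/ 0 !         ≈⟨ *-congʳ (+-identityʳ 1#) ⟨
      (1 × 1#) * 1/ 0 !   ≈⟨ recip-inverseʳ _ _ ⟩
      1#                  ∎

    coeff₀ : 1# - 1# * 1/ 0 ! ≈ 0#
    coeff₀ = begin
      1# - 1# * 1/ 0 !  ≈⟨ +-congˡ (-‿cong (trans (*-identityˡ _) 1/0!≈1)) ⟩
      1# - 1#           ≈⟨ -‿inverseʳ 1# ⟩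
      0#                ∎

  -- The functions of (s , x) are evaluated at arbitrary points of K with every x a nonzero.
  -- The poles of the constant terms lie on the hyperplanes x a = 0, so an identity of
  -- meromorphic functions is its validity at all such points; the case where s and the
  -- x a are independent variables is the one where K is itself a field of functions.
  module _ {n} (x : Vector Carrier n) (x#0 : ∀ a → x a # 0#) where

    V B : ℕ → Carrier → Laurent
    V p s = sumᴸ (subsetsOfSize n p) λ J →
      divide exp[t s ] (productᴸ (elements J) λ a → -[t x a ])
                       (leading-product (elements J) _ λ a → leading-monomial (x a) (x#0 a))
    B p s = sumᴸ (subsetsOfSize n p) λ J →
      divide exp[t s ] (productᴸ (elements J) λ a → 1-exp[t x a ])
                       (leading-product (elements J) _ λ a → leading-1-exp (x a) (x#0 a))

    CTV CTB : ℕ → Carrier → Carrier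
    CTV p s = constantTerm (V p s)
    CTB p s = constantTerm (B p s)

{-# OPTIONS --safe #-}
module Submission where

-- Put hₐ = t / (1 - e^{t xₐ}) and let ψⱼ be the coefficient of zʲ in (1 + z) ∏ₐ (t - hₐ (1 + z)).
-- Then Σ_p (-1)^p C(p+1, j) CTB_p(y) is the coefficient of tⁿ in e^{ty} ψⱼ.  Since hₐ(-t) = hₐ(t) - t,
-- the substitution t ↦ -t turns ψⱼ into ψ_{n+1-j}.  For odd n this makes the terms for m + i and m - i
-- equal, so the right-hand side is the coefficient of tⁿ in Σⱼ (j - m) e^{mst} ψⱼ Wʲ with W = -e^{-st}
-- (for even n, with (z - 1) ∏ … in place of ∏ …, m + 1 in place of m, and a factor 1/2).  Because 1 + W = st + …,
-- both Σⱼ ψⱼ Wʲ and its derivative in W are divisible by a power of t high enough for only the leading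
-- terms hₐ(0) = -1/xₐ to contribute, and these give the left-hand side.

open import Defs
open import Algebra.Apartness.Bundles using (HeytingField)
open import Data.Nat.Base as ℕ using (ℕ; NonZero; _∸_; _!)
open import Data.Nat.Combinatorics using (_C_)
open import Data.Product.Base as Product using ()
open import Data.Vec.Functional using (Vector)
open import Relation.Binary.PropositionalEquality using (_≡_)

open import Algebra.Apartness.Bundles using (HeytingCommutativeRing)
open import Algebra.Bundles using (CommutativeRing)
open import Algebra.Morphism.Structures using (module RingMorphisms)
import Algebra.Properties.CommutativeSemigroup
open import Data.Bool.Base using (true; false)
open import Data.Fin.Base as Fin using (Fin; toℕ)
import Data.Fin.Properties as Fin
open import Data.Fin.Subset using (Subset; inside; outside; ∣_∣)
open import Data.Fin.Subset.Properties using (_∈?_)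
open import Data.Integer.Base as ℤ using (ℤ; +_; -[1+_]; 0ℤ; 1ℤ)
import Data.Integer.Properties as ℤ
open import Data.List.Base using (List; []; _∷_; _++_; map; filter; foldr; allFin; length; tabulate)
open import Data.List.Properties using (filter-++; filter-none; map-tabulate; length-map; ++-identityʳ)
open import Data.List.Relation.Unary.All as All using (All; []; _∷_)
open import Data.List.Relation.Unary.All.Properties using (all-filter)
import Data.Maybe.Base as Maybe
open import Data.Nat.Base using (zero; suc; z≤n; s≤s)
open import Data.Nat.Combinatorics using (nCk≡n!/k![n-k]!; k![n∸k]!∣n!; nCk+nC[k+1]≡[n+1]C[k+1])
open import Data.Nat.Combinatorics.Specification using (k>n⇒nCk≡0)
import Data.Nat.DivMod as ℕ
import Data.Nat.Properties as ℕ
import Data.Vec.Base as Vec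
open import Data.Vec.Functional using (head; tail)
open import Function.Base using (_∘_; id)
import Relation.Binary.PropositionalEquality as ≡
open import Relation.Nullary.Decidable.Core using (does; dec⇒maybe)
open import Relation.Unary using (Pred; Decidable)

-- What has to disappear is everything in the hₐ beyond their constant terms. A value z = W with 1 +
-- W of order t achieves this, and the signs and exponents on the right-hand side dictate which W to
-- take. Evaluation at W needs all indices j up to the degree, whereas the theorem has only those
-- above the midpoint; the reflection t ↦ -t supplies the missing half. The factor j - m is odd
-- about the midpoint, so mirror terms agree only if the rest is odd too. Reading off the
-- coefficient of tⁿ contributes the sign (-1)ⁿ, which suffices for odd n. For even n the mirror
-- terms would cancel. The factor z - 1, which changes sign when its two coefficients are exchanged,
-- corrects this; it raises the degree to n + 2, which moves the midpoint, and it produces the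
-- differences of binomial coefficients. The 2 from folding is then matched by W(0) - 1 = -2. No
-- polynomial ring in z is built: a polynomial is its sequence of coefficients, and evaluation is a
-- linear functional on such sequences.

-- The library's ring solver needs a coefficient ring with enough decidable equalities.
module IntegerSolver {c ℓ} (R : CommutativeRing c ℓ) where

  open CommutativeRing R
  open import Algebra.Properties.Ring ring
    using (-0#≈0#; -‿distribˡ-*; -‿distribʳ-*; -‿involutive; -‿+-comm)
  open import Algebra.Properties.Semiring.Mult.TCOptimised semiring
    using (_×_; ×-homo-+; ×1-homo-*; ×-congʳ)
  open import Algebra.Solver.Ring.AlmostCommutativeRing
    using (fromCommutativeRing; _-Raw-AlmostCommutative⟶_)
  open import Relation.Binary.Reasoning.Setoid setoid

  -- With the optimised multiple, `1 × 1#` reduces to `1#`, so `1-homo` holds by `refl` and `con 1ℤ`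
  -- matches a literal `1#` in the equations to be solved.
  ⟦_⟧ℤ : ℤ → Carrier
  ⟦ + n      ⟧ℤ = n × 1#
  ⟦ -[1+ n ] ⟧ℤ = - (suc n × 1#)

  ⟦⟧-⊖ : ∀ m n → ⟦ m ℤ.⊖ n ⟧ℤ ≈ m × 1# - n × 1#
  ⟦⟧-⊖ m       zero    = sym (trans (+-congˡ -0#≈0#) (+-identityʳ _))
  ⟦⟧-⊖ zero    (suc n) = sym (+-identityˡ _)
  ⟦⟧-⊖ (suc m) (suc n) = begin
    ⟦ suc m ℤ.⊖ suc n ⟧ℤ             ≡⟨ ≡.cong ⟦_⟧ℤ (ℤ.[1+m]⊖[1+n]≡m⊖n m n) ⟩
    ⟦ m ℤ.⊖ n ⟧ℤ                     ≈⟨ ⟦⟧-⊖ m n ⟩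
    m × 1# - n × 1#                  ≈⟨ +-congˡ (+-identityˡ _) ⟨
    m × 1# + (0# - n × 1#)           ≈⟨ +-congˡ (+-congʳ (-‿inverseʳ 1#)) ⟨
    m × 1# + (1# - 1# - n × 1#)      ≈⟨ +-congˡ (+-assoc _ _ _) ⟩
    m × 1# + (1# + (- 1# - n × 1#))  ≈⟨ +-assoc _ _ _ ⟨
    m × 1# + 1# + (- 1# - n × 1#)    ≈⟨ +-cong (+-comm _ _) (-‿+-comm _ _) ⟩
    1# + m × 1# - (1# + n × 1#)      ≈⟨ +-cong (×-homo-+ 1# 1 m) (-‿cong (×-homo-+ 1# 1 n)) ⟨
    suc m × 1# - suc n × 1#          ∎

  ⟦⟧-+ : ∀ i j → ⟦ i ℤ.+ j ⟧ℤ ≈ ⟦ i ⟧ℤ + ⟦ j ⟧ℤ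
  ⟦⟧-+ (+ m)    (+ n)    = ×-homo-+ 1# m n
  ⟦⟧-+ (+ m)    -[1+ n ] = ⟦⟧-⊖ m (suc n)
  ⟦⟧-+ -[1+ m ] (+ n)    = trans (⟦⟧-⊖ n (suc m)) (+-comm _ _)
  ⟦⟧-+ -[1+ m ] -[1+ n ] = begin
    - (suc (suc (m ℕ.+ n)) × 1#)     ≡⟨ ≡.cong (λ k → - (suc k × 1#)) (ℕ.+-suc m n) ⟨
    - ((suc m ℕ.+ suc n) × 1#)       ≈⟨ -‿cong (×-homo-+ 1# (suc m) (suc n)) ⟩
    - (suc m × 1# + suc n × 1#)      ≈⟨ -‿+-comm _ _ ⟨
    - (suc m × 1#) - suc n × 1#      ∎

  ⟦⟧-neg : ∀ i → ⟦ ℤ.- i ⟧ℤ ≈ - ⟦ i ⟧ℤ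
  ⟦⟧-neg (+ zero)  = sym -0#≈0#
  ⟦⟧-neg (+ suc n) = refl
  ⟦⟧-neg -[1+ n ]  = sym (-‿involutive _)

  ⟦⟧-pos* : ∀ m n → ⟦ + m ℤ.* + n ⟧ℤ ≈ m × 1# * (n × 1#)
  ⟦⟧-pos* m n = trans (reflexive (≡.cong ⟦_⟧ℤ (≡.sym (ℤ.pos-* m n)))) (×1-homo-* m n)

  ⟦⟧-+* : ∀ m j → ⟦ + m ℤ.* j ⟧ℤ ≈ m × 1# * ⟦ j ⟧ℤ
  ⟦⟧-+* m (+ n)    = ⟦⟧-pos* m n
  ⟦⟧-+* m -[1+ n ] = begin
    ⟦ + m ℤ.* -[1+ n ] ⟧ℤ        ≡⟨ ≡.cong ⟦_⟧ℤ (ℤ.neg-distribʳ-* (+ m) (+ suc n)) ⟨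
    ⟦ ℤ.- (+ m ℤ.* + suc n) ⟧ℤ   ≈⟨ ⟦⟧-neg (+ m ℤ.* + suc n) ⟩
    - ⟦ + m ℤ.* + suc n ⟧ℤ       ≈⟨ -‿cong (⟦⟧-pos* m (suc n)) ⟩
    - (m × 1# * (suc n × 1#))    ≈⟨ -‿distribʳ-* _ _ ⟩
    m × 1# * - (suc n × 1#)      ∎

  ⟦⟧-* : ∀ i j → ⟦ i ℤ.* j ⟧ℤ ≈ ⟦ i ⟧ℤ * ⟦ j ⟧ℤ
  ⟦⟧-* (+ m)    j = ⟦⟧-+* m j
  ⟦⟧-* -[1+ m ] j = begin
    ⟦ -[1+ m ] ℤ.* j ⟧ℤ          ≡⟨ ≡.cong ⟦_⟧ℤ (ℤ.neg-distribˡ-* (+ suc m) j) ⟨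
    ⟦ ℤ.- (+ suc m ℤ.* j) ⟧ℤ     ≈⟨ ⟦⟧-neg (+ suc m ℤ.* j) ⟩
    - ⟦ + suc m ℤ.* j ⟧ℤ         ≈⟨ -‿cong (⟦⟧-+* (suc m) j) ⟩
    - (suc m × 1# * ⟦ j ⟧ℤ)      ≈⟨ -‿distribˡ-* _ _ ⟩
    - (suc m × 1#) * ⟦ j ⟧ℤ      ∎

  homomorphism : ℤ.+-*-rawRing -Raw-AlmostCommutative⟶ fromCommutativeRing R
  homomorphism = record
    { ⟦_⟧    = ⟦_⟧ℤ
    ; +-homo = ⟦⟧-+
    ; *-homo = ⟦⟧-*
    ; -‿homo = ⟦⟧-neg
    ; 0-homo = refl
    ; 1-homo = refl
    }

  open import Algebra.Solver.Ring ℤ.+-*-rawRing (fromCommutativeRing R) homomorphism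
    (λ i j → Maybe.map (λ i≡j → reflexive (≡.cong ⟦_⟧ℤ i≡j)) (dec⇒maybe (i ℤ.≟ j)))
    public using (solve; con; _:=_; _:+_; _:*_; _:-_; :-_)

-- Finite sums and binomial sums in a commutative ring.

module FiniteSums {c ℓ} (R : CommutativeRing c ℓ) where

  open CommutativeRing R hiding (zero)
  open import Algebra.Properties.Semiring.Mult semiring public
    using (_×_; ×-homo-+; ×1-homo-*; ×-assoc-*; ×-congʳ; ×-congˡ; ×-homo-1)
  open import Algebra.Properties.Semiring.Exp semiring public using (_^_; ^-homo-*; ^-congˡ)
  open import Algebra.Properties.Semiring.Sum semiring
  open import Algebra.Properties.Ring ring public using (-0#≈0#)
  open import Relation.Binary.Reasoning.Setoid setoid
  open IntegerSolver R

  opaque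
    -- Summands are functions on ℕ, so shifting or lengthening a sum needs no casts between `Fin`
    -- types. Opacity keeps `Σ (suc n) f` folded and lets unification recover `f`.
    Σ : ℕ → (ℕ → Carrier) → Carrier
    Σ n f = sum {n} (f ∘ toℕ)

    Σ-cong : ∀ n {f g : ℕ → Carrier} → (∀ j → j ℕ.< n → f j ≈ g j) → Σ n f ≈ Σ n g
    Σ-cong n f≈g = sum-cong-≋ λ j → f≈g (toℕ j) (Fin.toℕ<n j)

    Σ-cong′ : ∀ n {f g : ℕ → Carrier} → (∀ j → f j ≈ g j) → Σ n f ≈ Σ n g
    Σ-cong′ n f≈g = Σ-cong n λ j _ → f≈g j

    Σ-zero : ∀ n {f} → (∀ j → j ℕ.< n → f j ≈ 0#) → Σ n f ≈ 0#
    Σ-zero n f≈0 = trans (Σ-cong n f≈0) (sum-replicate-zero n)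

    Σ-distrib-+ : ∀ n f g → Σ n (λ j → f j + g j) ≈ Σ n f + Σ n g
    Σ-distrib-+ n f g = ∑-distrib-+ {n} (f ∘ toℕ) (g ∘ toℕ)

    Σ-distribˡ : ∀ n x f → x * Σ n f ≈ Σ n (λ j → x * f j)
    Σ-distribˡ n x f = *-distribˡ-sum {n} x (f ∘ toℕ)

    Σ-comm : ∀ m n (f : ℕ → ℕ → Carrier) → Σ m (λ i → Σ n (f i)) ≈ Σ n (λ j → Σ m (λ i → f i j))
    Σ-comm m n f = ∑-comm {m} {n} (λ i j → f (toℕ i) (toℕ j))

    Σ-last : ∀ n f → Σ (suc n) f ≈ Σ n f + f n
    Σ-last zero    f = +-comm _ _
    Σ-last (suc n) f = trans (+-congˡ (Σ-last n (f ∘ suc))) (sym (+-assoc _ _ _))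

    Σ-split : ∀ m n f → Σ (m ℕ.+ n) f ≈ Σ m f + Σ n (λ j → f (m ℕ.+ j))
    Σ-split zero    n f = sym (+-identityˡ _)
    Σ-split (suc m) n f = trans (+-congˡ (Σ-split m n (f ∘ suc))) (sym (+-assoc _ _ _))

    Σ-0 : ∀ f → Σ 0 f ≈ 0#
    Σ-0 f = refl

    Σ-suc : ∀ n f → Σ (suc n) f ≈ f 0 + Σ n (f ∘ suc)
    Σ-suc n f = refl

  Σ-1 : ∀ f → Σ 1 f ≈ f 0
  Σ-1 f = trans (Σ-suc 0 f) (trans (+-congˡ (Σ-0 _)) (+-identityʳ _))

  Σ-extend : ∀ {m n f} → m ℕ.≤ n → (∀ j → m ℕ.≤ j → f j ≈ 0#) → Σ m f ≈ Σ n f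
  Σ-extend {m} {n} {f} m≤n f≈0 = begin
    Σ m f                                  ≈⟨ +-identityʳ _ ⟨
    Σ m f + 0#                             ≈⟨ +-congˡ (Σ-zero (n ∸ m) λ j _ → f≈0 (m ℕ.+ j) (ℕ.m≤m+n m j)) ⟨
    Σ m f + Σ (n ∸ m) (λ j → f (m ℕ.+ j))  ≈⟨ Σ-split m (n ∸ m) f ⟨
    Σ (m ℕ.+ (n ∸ m)) f                    ≡⟨ ≡.cong (λ k → Σ k f) (ℕ.m+[n∸m]≡n m≤n) ⟩
    Σ n f                                  ∎

  Σ-drop : ∀ {m n f} → m ℕ.≤ n → (∀ j → j ℕ.< m → f j ≈ 0#) → Σ (n ∸ m) (λ j → f (m ℕ.+ j)) ≈ Σ n f
  Σ-drop {m} {n} {f} m≤n f≈0 = begin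
    Σ (n ∸ m) (λ j → f (m ℕ.+ j))          ≈⟨ +-identityˡ _ ⟨
    0# + Σ (n ∸ m) (λ j → f (m ℕ.+ j))     ≈⟨ +-congʳ (Σ-zero m f≈0) ⟨
    Σ m f + Σ (n ∸ m) (λ j → f (m ℕ.+ j))  ≈⟨ Σ-split m (n ∸ m) f ⟨
    Σ (m ℕ.+ (n ∸ m)) f                    ≡⟨ ≡.cong (λ k → Σ k f) (ℕ.m+[n∸m]≡n m≤n) ⟩
    Σ n f                                  ∎

  Σ-reverse : ∀ n {f g : ℕ → Carrier} → (∀ i j → suc (i ℕ.+ j) ≡ n → f i ≈ g j) → Σ n f ≈ Σ n g
  Σ-reverse zero            _   = trans (Σ-0 _) (sym (Σ-0 _))
  Σ-reverse (suc n) {f} {g} f≈g = begin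
    Σ (suc n) f          ≈⟨ Σ-suc n f ⟩
    f 0 + Σ n (f ∘ suc)  ≈⟨ +-cong (f≈g 0 n ≡.refl) (Σ-reverse n λ i j eq → f≈g (suc i) j (≡.cong suc eq)) ⟩
    g n + Σ n g          ≈⟨ +-comm _ _ ⟩
    Σ n g + g n          ≈⟨ Σ-last n g ⟨
    Σ (suc n) g          ∎

  -- Each index below `m` is paired with its mirror image above `m`; as the middle term vanishes,
  -- two equal halves remain.
  Σ-symmetric : ∀ m {f : ℕ → Carrier} → (∀ i j → i ℕ.+ j ≡ m ℕ.+ m → f i ≈ f j) → f m ≈ 0# →
                Σ (suc (m ℕ.+ m)) f ≈ 2 × Σ m (λ i → f (m ℕ.+ suc i))
  Σ-symmetric m {f} sym-f fm≈0 = begin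
    Σ (suc (m ℕ.+ m)) f                        ≡⟨ ≡.cong (λ k → Σ k f) (ℕ.+-suc m m) ⟨
    Σ (m ℕ.+ suc m) f                          ≈⟨ Σ-split m (suc m) f ⟩
    Σ m f + Σ (suc m) (f ∘ (m ℕ.+_))           ≈⟨ +-congˡ (Σ-suc m _) ⟩
    Σ m f + (f (m ℕ.+ 0) + upper)              ≈⟨ +-cong lower≈upper (trans (+-congʳ middle) (+-identityˡ _)) ⟩
    upper + upper                              ≈⟨ +-congˡ (+-identityʳ upper) ⟨
    2 × upper                                  ∎
    where
    upper : Carrier
    upper = Σ m (λ i → f (m ℕ.+ suc i))

    middle : f (m ℕ.+ 0) ≈ 0#
    middle = trans (reflexive (≡.cong f (ℕ.+-identityʳ m))) fm≈0

    lower≈upper : Σ m f ≈ upper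
    lower≈upper = Σ-reverse m λ i j eq → sym-f i (m ℕ.+ suc j)
      (≡.trans (ℕ-+.x∙yz≈y∙xz i m (suc j)) (≡.cong (m ℕ.+_) (≡.trans (ℕ.+-suc i j) eq)))
      where module ℕ-+ = Algebra.Properties.CommutativeSemigroup ℕ.+-commutativeSemigroup

  ×≈×1* : ∀ k x → k × x ≈ (k × 1#) * x
  ×≈×1* k x = sym (trans (×-assoc-* k 1# x) (×-congʳ k (*-identityˡ x)))

  ^-distrib-* : ∀ x y n → (x * y) ^ n ≈ x ^ n * y ^ n
  ^-distrib-* x y zero    = sym (*-identityˡ 1#)
  ^-distrib-* x y (suc n) = trans (*-congˡ (^-distrib-* x y n))
    (solve 4 (λ x y a b → x :* y :* (a :* b) := x :* a :* (y :* b)) refl x y _ _)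

  -- Binomial sums of an arbitrary sequence, so that Pascal's rule covers (1 + w)ⁿ and its derivative alike.
  binomialSum : ℕ → (ℕ → Carrier) → Carrier
  binomialSum n f = Σ (suc n) λ j → ((n C j) × 1#) * f j

  C-vanish : ∀ {n k} → n ℕ.< k → (n C k) × 1# ≈ 0#
  C-vanish n<k = ×-congˡ (k>n⇒nCk≡0 n<k)

  pascal : ∀ n k → (suc n C suc k) × 1# ≈ (n C k) × 1# + (n C suc k) × 1#
  pascal n k = trans (×-congˡ (≡.sym (nCk+nC[k+1]≡[n+1]C[k+1] n k))) (×-homo-+ 1# (n C k) (n C suc k))

  binomialSum-suc : ∀ n f → binomialSum (suc n) f ≈ binomialSum n f + binomialSum n (f ∘ suc)
  binomialSum-suc n f = begin
    binomialSum (suc n) f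
      ≈⟨ Σ-suc (suc n) _ ⟩
    a (suc n) 0 * f 0 + Σ (suc n) (λ j → a (suc n) (suc j) * f (suc j))
      ≈⟨ +-congˡ (Σ-cong′ (suc n) λ j → trans (*-congʳ (trans (pascal n j) (+-comm _ _))) (distribʳ _ _ _)) ⟩
    -- `suc n C 0` and `n C 0` reduce to the same number, so the first term changes silently.
    a n 0 * f 0 + Σ (suc n) (λ j → a n (suc j) * f (suc j) + a n j * f (suc j))
      ≈⟨ +-congˡ (Σ-distrib-+ (suc n) (λ j → a n (suc j) * f (suc j)) (λ j → a n j * f (suc j))) ⟩
    a n 0 * f 0 + (Σ (suc n) (λ j → a n (suc j) * f (suc j)) + binomialSum n (f ∘ suc))
      ≈⟨ trans (+-congʳ (Σ-suc (suc n) _)) (+-assoc _ _ _) ⟨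
    Σ (suc (suc n)) (λ j → a n j * f j) + binomialSum n (f ∘ suc)
      ≈⟨ +-congʳ (Σ-extend (ℕ.n≤1+n (suc n)) λ j n<j → trans (*-congʳ (C-vanish n<j)) (zeroˡ _)) ⟨
    binomialSum n f + binomialSum n (f ∘ suc) ∎
    where
    a : ℕ → ℕ → Carrier
    a n j = (n C j) × 1#

  binomialSum-cong : ∀ n {f g} → (∀ j → f j ≈ g j) → binomialSum n f ≈ binomialSum n g
  binomialSum-cong n f≈g = Σ-cong′ (suc n) λ j → *-congˡ (f≈g j)

  binomialSum-+ : ∀ n f g → binomialSum n (λ j → f j + g j) ≈ binomialSum n f + binomialSum n g
  binomialSum-+ n f g = trans (Σ-cong′ (suc n) λ j → distribˡ _ (f j) (g j))
    (Σ-distrib-+ (suc n) (λ j → ((n C j) × 1#) * f j) (λ j → ((n C j) × 1#) * g j))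

  binomialSum-* : ∀ n a f → binomialSum n (λ j → a * f j) ≈ a * binomialSum n f
  binomialSum-* n a f = trans
    (Σ-cong′ (suc n) λ j → solve 3 (λ c a x → c :* (a :* x) := a :* (c :* x)) refl ((n C j) × 1#) a (f j))
    (sym (Σ-distribˡ (suc n) a λ j → ((n C j) × 1#) * f j))

  binomialSum-^ : ∀ n w → binomialSum n (w ^_) ≈ (1# + w) ^ n
  binomialSum-^ zero    w = trans (Σ-1 _) (trans (*-identityʳ _) (×-homo-1 1#))
  binomialSum-^ (suc n) w = begin
    binomialSum (suc n) (w ^_)                           ≈⟨ binomialSum-suc n (w ^_) ⟩
    binomialSum n (w ^_) + binomialSum n (λ j → w * w ^ j) ≈⟨ +-congˡ (binomialSum-* n w (w ^_)) ⟩
    binomialSum n (w ^_) + w * binomialSum n (w ^_)       ≈⟨ solve 2 (λ w b → b :+ w :* b := (con 1ℤ :+ w) :* b) refl w _ ⟩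
    (1# + w) * binomialSum n (w ^_)                      ≈⟨ *-congˡ (binomialSum-^ n w) ⟩
    (1# + w) ^ suc n                                     ∎

  -- This is w d/dw of the binomial theorem. In place of a derivative, Pascal's rule and
  -- `θ (suc j) ≈ w * (θ j + w ^ j)` drive the induction.
  binomialSum-j^ : ∀ n w → binomialSum (suc n) (λ j → (j × 1#) * w ^ j) ≈ ((suc n × 1#) * w) * (1# + w) ^ n
  binomialSum-j^ zero    w = begin
    binomialSum 1 (λ j → (j × 1#) * w ^ j)
      ≈⟨ trans (Σ-suc 1 _) (+-congˡ (trans (Σ-1 _) (sym (+-identityʳ _)))) ⟩
    ((1 C 0) × 1#) * (0# * 1#) + (((1 C 1) × 1#) * ((1 × 1#) * (w * 1#)) + 0#)
      ≈⟨ +-congʳ (trans (*-congˡ (zeroˡ _)) (zeroʳ _)) ⟩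
    0# + (((1 C 1) × 1#) * ((1 × 1#) * (w * 1#)) + 0#)
      ≈⟨ trans (+-identityˡ _) (trans (+-identityʳ _) (trans (*-congʳ (×-homo-1 1#)) (trans (*-identityˡ _) (sym (*-assoc _ _ _))))) ⟩
    ((1 × 1#) * w) * 1# ∎
  binomialSum-j^ (suc n) w = begin
    binomialSum (suc (suc n)) θ
      ≈⟨ binomialSum-suc (suc n) θ ⟩
    binomialSum (suc n) θ + binomialSum (suc n) (θ ∘ suc)
      ≈⟨ +-congˡ (binomialSum-cong (suc n) λ j → solve 3 (λ j w p → (con 1ℤ :+ j) :* (w :* p) := w :* (j :* p :+ p)) refl (j × 1#) w (w ^ j)) ⟩
    binomialSum (suc n) θ + binomialSum (suc n) (λ j → w * (θ j + w ^ j))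
      ≈⟨ +-congˡ (trans (binomialSum-* (suc n) w _) (*-congˡ (binomialSum-+ (suc n) θ (w ^_)))) ⟩
    binomialSum (suc n) θ + w * (binomialSum (suc n) θ + binomialSum (suc n) (w ^_))
      ≈⟨ +-cong (binomialSum-j^ n w) (*-congˡ (+-cong (binomialSum-j^ n w) (binomialSum-^ (suc n) w))) ⟩
    ((suc n × 1#) * w) * p + w * (((suc n × 1#) * w) * p + (1# + w) * p)
      ≈⟨ solve 3 (λ k w p → k :* w :* p :+ w :* (k :* w :* p :+ (con 1ℤ :+ w) :* p)
                         := (con 1ℤ :+ k) :* w :* ((con 1ℤ :+ w) :* p)) refl (suc n × 1#) w p ⟩
    ((suc (suc n) × 1#) * w) * ((1# + w) * p) ∎
    where
    θ : ℕ → Carrier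
    θ j = (j × 1#) * w ^ j
    p : Carrier
    p = (1# + w) ^ n

-- Elementary symmetric functions and the coefficients of (1 + z) ∏ₐ (t - vₐ (1 + z)).

module ElementarySymmetric {c ℓ} (R : CommutativeRing c ℓ) where

  open CommutativeRing R hiding (zero)
  open FiniteSums R
  open import Relation.Binary.Reasoning.Setoid setoid
  open IntegerSolver R

  esym : ∀ {n} → Vector Carrier n → ℕ → Carrier
  esym {zero}  v zero    = 1#
  esym {zero}  v (suc p) = 0#
  esym {suc n} v zero    = esym (tail v) zero
  esym {suc n} v (suc p) = esym (tail v) (suc p) + head v * esym (tail v) p

  esym-vanish : ∀ {n} (v : Vector Carrier n) {p} → n ℕ.< p → esym v p ≈ 0#
  esym-vanish {zero}  v {suc p} n<p       = refl
  esym-vanish {suc n} v {suc p} (s≤s n<p) = begin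
    esym (tail v) (suc p) + head v * esym (tail v) p  ≈⟨ +-cong (esym-vanish (tail v) (ℕ.m<n⇒m<1+n n<p)) (*-congˡ (esym-vanish (tail v) n<p)) ⟩
    0# + head v * 0#                                  ≈⟨ trans (+-identityˡ _) (zeroʳ _) ⟩
    0#                                                ∎

  -- The image of ∏ₐ (t + vₐ u) under the linear map uᵖ ↦ c p.
  weighted : ∀ {n} → Carrier → Vector Carrier n → (ℕ → Carrier) → Carrier
  weighted {n} t v c = Σ (suc n) λ p → c p * (t ^ (n ∸ p) * esym v p)

  weighted-cong : ∀ {n} t (v : Vector Carrier n) {c d} → (∀ p → p ℕ.≤ n → c p ≈ d p) →
                  weighted t v c ≈ weighted t v d
  weighted-cong {n} t v c≈d = Σ-cong (suc n) λ p p≤n → *-congʳ (c≈d p (ℕ.s≤s⁻¹ p≤n))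

  weighted-* : ∀ {n} t (v : Vector Carrier n) a c → weighted t v (λ p → a * c p) ≈ a * weighted t v c
  weighted-* {n} t v a c = trans (Σ-cong′ (suc n) λ p → *-assoc a (c p) _) (sym (Σ-distribˡ (suc n) a _))

  weighted-+ : ∀ {n} t (v : Vector Carrier n) c d →
               weighted t v (λ p → c p + d p) ≈ weighted t v c + weighted t v d
  weighted-+ {n} t v c d = trans (Σ-cong′ (suc n) λ p → distribʳ _ (c p) (d p)) (Σ-distrib-+ (suc n) _ _)

  -- Expand the factor t + v₀ u of the first entry: t scales the remaining product, and u shifts the
  -- sequence `c` by one.
  weighted-suc : ∀ {n} t (v : Vector Carrier (suc n)) c →
                 weighted t v c ≈ t * weighted t (tail v) c + head v * weighted t (tail v) (c ∘ suc)
  weighted-suc {n} t v c = begin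
    weighted t v c
      ≈⟨ Σ-suc (suc n) _ ⟩
    c 0 * (t ^ suc n * e 0) + Σ (suc n) (λ p → c (suc p) * (t ^ (n ∸ p) * (e (suc p) + h * e p)))
      ≈⟨ +-congˡ (Σ-cong′ (suc n) λ p → solve 5 (λ c t e′ h e → c :* (t :* (e′ :+ h :* e)) := c :* (t :* e′) :+ h :* (c :* (t :* e)))
           refl (c (suc p)) (t ^ (n ∸ p)) (e (suc p)) h (e p)) ⟩
    c 0 * (t ^ suc n * e 0) + Σ (suc n) (λ p → c (suc p) * (t ^ (n ∸ p) * e (suc p)) + h * (c (suc p) * (t ^ (n ∸ p) * e p)))
      ≈⟨ +-congˡ (Σ-distrib-+ (suc n) _ _) ⟩
    c 0 * (t ^ suc n * e 0) + (Σ (suc n) (λ p → c (suc p) * (t ^ (n ∸ p) * e (suc p))) + Σ (suc n) (λ p → h * (c (suc p) * (t ^ (n ∸ p) * e p))))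
      ≈⟨ trans (+-congʳ (Σ-suc (suc n) _)) (trans (+-assoc _ _ _) (+-congˡ (+-congˡ (Σ-distribˡ (suc n) h _)))) ⟨
    Σ (suc (suc n)) (λ p → c p * (t ^ (suc n ∸ p) * e p)) + h * weighted t (tail v) (c ∘ suc)
      -- The vanishing term p = n + 1 is dropped first, because `suc n ∸ p ≡ suc (n ∸ p)` needs p ≤
      -- n.
      ≈⟨ +-congʳ (Σ-extend (ℕ.n≤1+n (suc n)) λ p n<p → trans (*-congˡ (trans (*-congˡ (esym-vanish (tail v) n<p)) (zeroʳ _))) (zeroʳ _)) ⟨
    Σ (suc n) (λ p → c p * (t ^ (suc n ∸ p) * e p)) + h * weighted t (tail v) (c ∘ suc)
      ≈⟨ +-congʳ (Σ-cong (suc n) λ p p<1+n → trans (*-congˡ (*-congʳ (reflexive (≡.cong (t ^_) (ℕ.+-∸-assoc 1 (ℕ.s≤s⁻¹ p<1+n))))))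
           (solve 4 (λ c t a e → c :* (t :* a :* e) := t :* (c :* (a :* e))) refl (c p) t (t ^ (n ∸ p)) (e p))) ⟩
    Σ (suc n) (λ p → t * (c p * (t ^ (n ∸ p) * e p))) + h * weighted t (tail v) (c ∘ suc)
      ≈⟨ +-congʳ (Σ-distribˡ (suc n) t _) ⟨
    t * weighted t (tail v) c + h * weighted t (tail v) (c ∘ suc) ∎
    where
    h : Carrier
    h = head v
    e : ℕ → Carrier
    e = esym (tail v)

  sign : ℕ → Carrier
  sign p = (- 1#) ^ p

  -- The coefficient of zʲ in (1 + z) uᵖ for u = -(1 + z).
  signedChoose : ℕ → ℕ → Carrier
  signedChoose j p = sign p * ((suc p C j) × 1#)

  -- The coefficients of zʲ in (1 + z) ∏ₐ (t - vₐ (1 + z)).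
  coefficient : ∀ {n} → Carrier → Vector Carrier n → ℕ → Carrier
  coefficient t v j = weighted t v (signedChoose j)

  coefficient-vanish : ∀ {n} t (v : Vector Carrier n) {j} → suc n ℕ.< j → coefficient t v j ≈ 0#
  coefficient-vanish {n} t v {j} n<j = Σ-zero (suc n) λ p p<1+n →
    trans (*-congʳ (trans (*-congˡ (C-vanish (ℕ.≤-<-trans p<1+n n<j))) (zeroʳ _))) (zeroˡ _)

  -- The new factor is (t - v₀) - v₀ z. Its effect is stated separately at z⁰, where no lower
  -- coefficient contributes, and at higher powers, where Pascal's rule supplies the lower one.
  coefficient-suc-0 : ∀ {n} t (v : Vector Carrier (suc n)) →
                      coefficient t v 0 ≈ (t - head v) * coefficient t (tail v) 0
  coefficient-suc-0 t v = begin
    coefficient t v 0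
      ≈⟨ weighted-suc t v _ ⟩
    t * coefficient t (tail v) 0 + head v * weighted t (tail v) (signedChoose 0 ∘ suc)
      ≈⟨ +-congˡ (*-congˡ (trans (weighted-cong t (tail v) λ p _ → *-assoc _ _ _) (weighted-* t (tail v) (- 1#) _))) ⟩
    t * coefficient t (tail v) 0 + head v * (- 1# * coefficient t (tail v) 0)
      ≈⟨ solve 3 (λ t h x → t :* x :+ h :* (:- con 1ℤ :* x) := (t :- h) :* x) refl t (head v) _ ⟩
    (t - head v) * coefficient t (tail v) 0 ∎

  coefficient-suc-suc : ∀ {n} t (v : Vector Carrier (suc n)) j →
                        coefficient t v (suc j) ≈ (t - head v) * coefficient t (tail v) (suc j) - head v * coefficient t (tail v) j
  coefficient-suc-suc t v j = begin
    coefficient t v (suc j)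
      ≈⟨ weighted-suc t v _ ⟩
    t * x + head v * weighted t (tail v) (signedChoose (suc j) ∘ suc)
      ≈⟨ +-congˡ (*-congˡ (weighted-cong t (tail v) λ p _ → trans (*-congˡ (pascal (suc p) j))
           (solve 3 (λ s a b → :- con 1ℤ :* s :* (a :+ b) := :- con 1ℤ :* (s :* a :+ s :* b)) refl (sign p) _ _))) ⟩
    t * x + head v * weighted t (tail v) (λ p → - 1# * (signedChoose j p + signedChoose (suc j) p))
      ≈⟨ +-congˡ (*-congˡ (trans (weighted-* t (tail v) (- 1#) _) (*-congˡ (weighted-+ t (tail v) _ _)))) ⟩
    t * x + head v * (- 1# * (y + x))
      ≈⟨ solve 4 (λ t h x y → t :* x :+ h :* (:- con 1ℤ :* (y :+ x)) := (t :- h) :* x :- h :* y) refl t (head v) x y ⟩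
    (t - head v) * x - head v * y ∎
    where
    x y : Carrier
    x = coefficient t (tail v) (suc j)
    y = coefficient t (tail v) j

  -- The linear functional zʲ ↦ `f j` sends (1 + z)ᵖ⁺¹ to `binomialSum (suc p) f`. The range ends at
  -- n + 1, the degree in z.
  Σ-coefficient : ∀ {n} t (v : Vector Carrier n) f →
                  Σ (suc (suc n)) (λ j → f j * coefficient t v j) ≈ weighted t v (λ p → sign p * binomialSum (suc p) f)
  Σ-coefficient {n} t v f = begin
    Σ (2 ℕ.+ n) (λ j → f j * coefficient t v j)
      ≈⟨ Σ-cong′ (2 ℕ.+ n) (λ j → Σ-distribˡ (suc n) (f j) _) ⟩
    Σ (2 ℕ.+ n) (λ j → Σ (suc n) (λ p → f j * (signedChoose j p * m p)))
      ≈⟨ Σ-comm (2 ℕ.+ n) (suc n) _ ⟩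
    Σ (suc n) (λ p → Σ (2 ℕ.+ n) (λ j → f j * (signedChoose j p * m p)))
      ≈⟨ Σ-cong (suc n) (λ p p<1+n → begin
           Σ (2 ℕ.+ n) (λ j → f j * (signedChoose j p * m p))
             ≈⟨ Σ-cong′ (2 ℕ.+ n) (λ j → solve 4 (λ f s a m → f :* (s :* a :* m) := s :* m :* (a :* f)) refl (f j) (sign p) _ (m p)) ⟩
           Σ (2 ℕ.+ n) (λ j → sign p * m p * (((suc p C j) × 1#) * f j))
             ≈⟨ Σ-distribˡ (2 ℕ.+ n) _ _ ⟨
           sign p * m p * Σ (2 ℕ.+ n) (λ j → ((suc p C j) × 1#) * f j)
             ≈⟨ *-congˡ (Σ-extend (s≤s p<1+n) λ j p<j → trans (*-congʳ (C-vanish p<j)) (zeroˡ _)) ⟨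
           sign p * m p * binomialSum (suc p) f
             ≈⟨ solve 3 (λ s m b → s :* m :* b := s :* b :* m) refl (sign p) (m p) _ ⟩
           sign p * binomialSum (suc p) f * m p ∎) ⟩
    weighted t v (λ p → sign p * binomialSum (suc p) f) ∎
    where
    m : ℕ → Carrier
    m p = t ^ (n ∸ p) * esym v p

  -- At z = w each factor t - vₐ (1 + z) becomes t (1 - vₐ r), and the extra 1 + z becomes t r, so
  -- the value at w is divisible by tⁿ⁺¹. The derivation w d/dw costs one power of t. Hence the
  -- common factor tⁿ, with one more t on the part with `b`.
  Σ-coefficient-j^ : ∀ {n} t (v : Vector Carrier n) {r w} → 1# + w ≈ t * r → ∀ a b →
    Σ (suc (suc n)) (λ j → (a * ((j × 1#) * w ^ j) + b * w ^ j) * coefficient t v j) ≈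
    t ^ n * (a * (w * Σ (suc n) (λ p → sign p * (suc p × 1#) * r ^ p * esym v p)) +
             t * (b * Σ (suc n) (λ p → sign p * r ^ suc p * esym v p)))
  Σ-coefficient-j^ {n} t v {r} {w} 1+w≈tr a b = begin
    Σ (suc (suc n)) (λ j → (a * ((j × 1#) * w ^ j) + b * w ^ j) * coefficient t v j)
      ≈⟨ Σ-coefficient t v _ ⟩
    weighted t v (λ p → sign p * binomialSum (suc p) (λ j → a * ((j × 1#) * w ^ j) + b * w ^ j))
      ≈⟨ Σ-cong (suc n) (λ p p<1+n → term p (ℕ.s≤s⁻¹ p<1+n)) ⟩
    Σ (suc n) (λ p → t ^ n * a * w * (sign p * (suc p × 1#) * r ^ p * e p) + t ^ n * t * b * (sign p * r ^ suc p * e p))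
      ≈⟨ Σ-distrib-+ (suc n) _ _ ⟩
    Σ (suc n) (λ p → t ^ n * a * w * (sign p * (suc p × 1#) * r ^ p * e p)) + Σ (suc n) (λ p → t ^ n * t * b * (sign p * r ^ suc p * e p))
      ≈⟨ +-cong (Σ-distribˡ (suc n) _ _) (Σ-distribˡ (suc n) _ _) ⟨
    t ^ n * a * w * Σ (suc n) (λ p → sign p * (suc p × 1#) * r ^ p * e p) + t ^ n * t * b * Σ (suc n) (λ p → sign p * r ^ suc p * e p)
      ≈⟨ solve 7 (λ tn t a b w q q′ → tn :* a :* w :* q :+ tn :* t :* b :* q′ := tn :* (a :* (w :* q) :+ t :* (b :* q′)))
           refl (t ^ n) t a b w _ _ ⟩
    _ ∎
    where
    e : ℕ → Carrier
    e = esym v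

    term : ∀ p → p ℕ.≤ n →
      sign p * binomialSum (suc p) (λ j → a * ((j × 1#) * w ^ j) + b * w ^ j) * (t ^ (n ∸ p) * e p) ≈
      t ^ n * a * w * (sign p * (suc p × 1#) * r ^ p * e p) + t ^ n * t * b * (sign p * r ^ suc p * e p)
    term p p≤n = begin
      sign p * binomialSum (suc p) (λ j → a * ((j × 1#) * w ^ j) + b * w ^ j) * (t ^ (n ∸ p) * e p)
        ≈⟨ *-congʳ (*-congˡ (begin
             binomialSum (suc p) (λ j → a * ((j × 1#) * w ^ j) + b * w ^ j)
               ≈⟨ trans (binomialSum-+ (suc p) _ _) (+-cong (binomialSum-* (suc p) a _) (binomialSum-* (suc p) b _)) ⟩
             a * binomialSum (suc p) (λ j → (j × 1#) * w ^ j) + b * binomialSum (suc p) (w ^_)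
               ≈⟨ +-cong (*-congˡ (binomialSum-j^ p w)) (*-congˡ (binomialSum-^ (suc p) w)) ⟩
             a * ((suc p × 1#) * w * (1# + w) ^ p) + b * ((1# + w) * (1# + w) ^ p)
               ≈⟨ +-cong (*-congˡ (*-congˡ power)) (*-congˡ (*-cong 1+w≈tr power)) ⟩
             a * ((suc p × 1#) * w * (t ^ p * r ^ p)) + b * (t * r * (t ^ p * r ^ p)) ∎)) ⟩
      sign p * (a * ((suc p × 1#) * w * (t ^ p * r ^ p)) + b * (t * r * (t ^ p * r ^ p))) * (t ^ (n ∸ p) * e p)
        ≈⟨ solve 11 (λ s a b k w t r tp rp tq e →
             s :* (a :* (k :* w :* (tp :* rp)) :+ b :* (t :* r :* (tp :* rp))) :* (tq :* e)
             := tp :* tq :* a :* w :* (s :* k :* rp :* e) :+ tp :* tq :* t :* b :* (s :* (r :* rp) :* e))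
             refl (sign p) a b (suc p × 1#) w t r (t ^ p) (r ^ p) (t ^ (n ∸ p)) (e p) ⟩
      t ^ p * t ^ (n ∸ p) * a * w * (sign p * (suc p × 1#) * r ^ p * e p) + t ^ p * t ^ (n ∸ p) * t * b * (sign p * r ^ suc p * e p)
        ≈⟨ +-cong (*-congʳ (*-congʳ (*-congʳ tⁿ))) (*-congʳ (*-congʳ (*-congʳ tⁿ))) ⟩
      t ^ n * a * w * (sign p * (suc p × 1#) * r ^ p * e p) + t ^ n * t * b * (sign p * r ^ suc p * e p) ∎
      where
      power : (1# + w) ^ p ≈ t ^ p * r ^ p
      power = trans (^-congˡ p 1+w≈tr) (^-distrib-* t r p)

      tⁿ : t ^ p * t ^ (n ∸ p) ≈ t ^ n
      tⁿ = trans (sym (^-homo-* t p (n ∸ p))) (reflexive (≡.cong (t ^_) (ℕ.m+[n∸m]≡n p≤n)))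

  -- If an endomorphism acts as t ↦ -t and vₐ ↦ vₐ - t, then t - vₐ(1 + z) becomes z (t - vₐ(1 + 1/z)).
  module _ {σ : Carrier → Carrier} (isHom : RingMorphisms.IsRingHomomorphism rawRing rawRing σ) {t} (σt : σ t ≈ - t) where

    open RingMorphisms.IsRingHomomorphism isHom using (⟦⟧-cong; +-homo; *-homo; -‿homo; 1#-homo; 0#-homo)

    private
      σ-t-h : ∀ {h} → σ h ≈ h - t → σ (t - h) ≈ - h
      σ-t-h {h} σh = begin
        σ (t - h)      ≈⟨ trans (+-homo t (- h)) (+-cong σt (trans (-‿homo h) (-‿cong σh))) ⟩
        - t - (h - t)  ≈⟨ solve 2 (λ t h → :- t :- (h :- t) := :- h) refl t h ⟩
        - h            ∎

      σ-* : ∀ {a b x y} → σ a ≈ b → σ x ≈ y → σ (a * x) ≈ b * y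
      σ-* {a} {b} {x} p q = trans (*-homo a x) (*-cong p q)

    -- `σ` sends t - vₐ to -vₐ and -vₐ to t - vₐ, so it exchanges the two coefficients of each
    -- factor (t - vₐ) - vₐ z, while 1 + z is its own reversal. Adding one factor at a time, it
    -- reverses the coefficients of the product.
    coefficient-palindrome : ∀ {n} (v : Vector Carrier n) → (∀ a → σ (v a) ≈ v a - t) →
                             ∀ i j → i ℕ.+ j ≡ suc n → σ (coefficient t v i) ≈ coefficient t v j
    coefficient-palindrome {zero} v σv i j i+j≡1 = trans (⟦⟧-cong (one i j i+j≡1)) (trans 1#-homo (sym (one j i (≡.trans (ℕ.+-comm j i) i+j≡1))))
      where
      value : ∀ {x} → x ≈ 1# → 1# * x * (1# * 1#) ≈ 1#
      value x≈1 = trans (*-cong (*-identityˡ _) (*-identityˡ 1#)) (trans (*-identityʳ _) x≈1)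

      one : ∀ i j → i ℕ.+ j ≡ 1 → coefficient t v i ≈ 1#
      one zero       j _ = trans (Σ-1 _) (value (×-homo-1 1#))
      one (suc zero) j _ = trans (Σ-1 _) (value (×-homo-1 1#))
    coefficient-palindrome {suc n} v σv zero j ≡.refl = begin
      σ (coefficient t v 0)                          ≈⟨ ⟦⟧-cong (coefficient-suc-0 t v) ⟩
      σ ((t - h) * coefficient t (tail v) 0)         ≈⟨ σ-* (σ-t-h (σv Fin.zero)) (coefficient-palindrome (tail v) (σv ∘ Fin.suc) 0 (suc n) ≡.refl) ⟩
      -- The coefficient of zⁿ⁺² lies above the degree of the shorter product; this zero is inserted
      -- so that `coefficient-suc-suc` applies.
      - h * y                                        ≈⟨ solve 3 (λ t h y → :- h :* y := (t :- h) :* con 0ℤ :- h :* y) refl t h y ⟩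
      (t - h) * 0# - h * y                           ≈⟨ +-congʳ (*-congˡ (coefficient-vanish t (tail v) ℕ.≤-refl)) ⟨
      (t - h) * coefficient t (tail v) (2 ℕ.+ n) - h * y  ≈⟨ coefficient-suc-suc t v (suc n) ⟨
      coefficient t v (2 ℕ.+ n)                      ∎
      where
      h y : Carrier
      h = head v
      y = coefficient t (tail v) (suc n)
    coefficient-palindrome {suc n} v σv (suc i) j eq = begin
      σ (coefficient t v (suc i))
        ≈⟨ ⟦⟧-cong (coefficient-suc-suc t v i) ⟩
      σ ((t - h) * x (suc i) - h * x i)
        ≈⟨ trans (+-homo _ _) (+-cong (*-homo _ _) (trans (-‿homo _) (-‿cong (*-homo _ _)))) ⟩
      σ (t - h) * σ (x (suc i)) - σ h * σ (x i)
        ≈⟨ +-cong (*-congʳ (σ-t-h (σv Fin.zero))) (-‿cong (*-cong (σv Fin.zero) (ih i j (ℕ.suc-injective eq)))) ⟩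
      - h * σ (x (suc i)) - (h - t) * x j
        ≈⟨ step j eq ⟩
      coefficient t v j ∎
      where
      h : Carrier
      h = head v
      x : ℕ → Carrier
      x = coefficient t (tail v)
      ih : ∀ i j → i ℕ.+ j ≡ suc n → σ (x i) ≈ x j
      ih = coefficient-palindrome (tail v) (σv ∘ Fin.suc)
      step : ∀ j → suc i ℕ.+ j ≡ 2 ℕ.+ n → - h * σ (x (suc i)) - (h - t) * x j ≈ coefficient t v j
      -- Here i = n + 1, so `x (suc i)` is again above the degree.
      step zero eq = begin
        - h * σ (x (suc i)) - (h - t) * x 0  ≈⟨ +-congʳ (*-congˡ (trans (⟦⟧-cong (coefficient-vanish t (tail v) (ℕ.≤-reflexive (≡.trans (≡.sym eq) (ℕ.+-identityʳ (suc i)))))) 0#-homo)) ⟩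
        - h * 0# - (h - t) * x 0             ≈⟨ solve 3 (λ t h y → :- h :* con 0ℤ :- (h :- t) :* y := (t :- h) :* y) refl t h (x 0) ⟩
        (t - h) * x 0                        ≈⟨ coefficient-suc-0 t v ⟨
        coefficient t v 0                    ∎
      step (suc j) eq = begin
        - h * σ (x (suc i)) - (h - t) * x (suc j)  ≈⟨ +-congʳ (*-congˡ (ih (suc i) j (ℕ.suc-injective (≡.trans (≡.sym (ℕ.+-suc (suc i) j)) eq)))) ⟩
        - h * x j - (h - t) * x (suc j)            ≈⟨ solve 4 (λ t h y y′ → :- h :* y :- (h :- t) :* y′ := (t :- h) :* y′ :- h :* y) refl t h (x j) (x (suc j)) ⟩
        (t - h) * x (suc j) - h * x j              ≈⟨ coefficient-suc-suc t v j ⟨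
        coefficient t v (suc j)                    ∎

-- Transport of sums, powers and symmetric functions along ring homomorphisms.

module Homomorphism {c ℓ d m} (R : CommutativeRing c ℓ) (S : CommutativeRing d m)
  {φ : CommutativeRing.Carrier R → CommutativeRing.Carrier S}
  (isHom : RingMorphisms.IsRingHomomorphism (CommutativeRing.rawRing R) (CommutativeRing.rawRing S) φ) where

  open RingMorphisms.IsRingHomomorphism isHom
  open CommutativeRing S hiding (zero)
  private
    module R where
      open CommutativeRing R public
      open FiniteSums R public
      open ElementarySymmetric R public
  open FiniteSums S
  open ElementarySymmetric S

  Σ-homo : ∀ n f → φ (R.Σ n f) ≈ Σ n (φ ∘ f)
  Σ-homo zero    f = trans (⟦⟧-cong (R.Σ-0 f)) (trans 0#-homo (sym (Σ-0 _)))
  Σ-homo (suc n) f = trans (⟦⟧-cong (R.Σ-suc n f))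
    (trans (+-homo _ _) (trans (+-congˡ (Σ-homo n (f ∘ suc))) (sym (Σ-suc n _))))

  ^-homo : ∀ x n → φ (x R.^ n) ≈ φ x ^ n
  ^-homo x zero    = 1#-homo
  ^-homo x (suc n) = trans (*-homo _ _) (*-congˡ (^-homo x n))

  ×1-homo : ∀ n → φ (n R.× R.1#) ≈ n × 1#
  ×1-homo zero    = 0#-homo
  ×1-homo (suc n) = trans (+-homo _ _) (+-cong 1#-homo (×1-homo n))

  sign-homo : ∀ n → φ (R.sign n) ≈ sign n
  sign-homo n = trans (^-homo _ n) (^-congˡ n (trans (-‿homo _) (-‿cong 1#-homo)))

  esym-homo : ∀ {n} (v : Vector R.Carrier n) p → φ (R.esym v p) ≈ esym (φ ∘ v) p
  esym-homo {zero}  v zero    = 1#-homo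
  esym-homo {zero}  v (suc p) = 0#-homo
  esym-homo {suc n} v zero    = esym-homo (tail v) zero
  esym-homo {suc n} v (suc p) = trans (+-homo _ _)
    (+-cong (esym-homo (tail v) (suc p)) (trans (*-homo _ _) (*-congˡ (esym-homo (tail v) p))))

-- The ring of formal power series in t, reciprocals and exponentials.

module PowerSeries {c ℓ₁ ℓ₂} (K : HeytingField c ℓ₁ ℓ₂) (char0 : CharacteristicZero K) where

  open Series-in-t K char0 hiding (zero)

  fieldRing : CommutativeRing c ℓ₁
  fieldRing = HeytingCommutativeRing.commutativeRing heytingCommutativeRing

  open FiniteSums fieldRing hiding (_×_; _^_; -0#≈0#)
  open ElementarySymmetric fieldRing using (sign)
  open IntegerSolver fieldRing
  open import Relation.Binary.Reasoning.Setoid setoid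

  opaque
    unfolding Σ
    rangeSum≈Σ : ∀ a b f → rangeSum a b f ≈ Σ (suc b ∸ a) (λ j → f (a ℕ.+ j))
    rangeSum≈Σ a b f = refl

  infix 4 _≋_
  -- A record, so that `f` and `g` can be inferred from a proof of their equality.
  record _≋_ (f g : Series) : Set ℓ₁ where
    constructor pointwise
    field at : ∀ k → f k ≈ g k
  open _≋_ public

  _⊕_ : Series → Series → Series
  (f ⊕ g) k = f k + g k

  ⊖_ : Series → Series
  (⊖ f) k = - f k

  const : Carrier → Series
  const a zero    = a
  const a (suc k) = 0#

  0ˢ : Series
  0ˢ k = 0#

  convolve-0 : ∀ f g → convolve f g 0 ≈ f 0 * g 0
  convolve-0 f g = +-identityʳ _

  convolve-cong : ∀ {f f′ g g′} k → (∀ j → f j ≈ f′ j) → (∀ j → g j ≈ g′ j) → convolve f g k ≈ convolve f′ g′ k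
  convolve-cong k f≈ g≈ = sum-cong-≋ {suc k} λ j → *-cong (f≈ (toℕ j)) (g≈ (k ∸ toℕ j))

  convolve-zeroˡ : ∀ f g k → (∀ j → f j ≈ 0#) → convolve f g k ≈ 0#
  convolve-zeroˡ f g k f≈0 = sum-zero {suc k} _ λ j → trans (*-congʳ (f≈0 (toℕ j))) (zeroˡ (g (k ∸ toℕ j)))

  convolve-const : ∀ a f k → convolve (const a) f k ≈ a * f k
  convolve-const a f zero    = convolve-0 (const a) f
  convolve-const a f (suc k) = trans (+-congˡ (convolve-zeroˡ 0ˢ f k λ _ → refl)) (+-identityʳ _)

  -- By definition `convolve` peels off the leading coefficient of `f`; peeling off that of `g`
  -- instead is what commutativity needs.
  convolve-sucʳ : ∀ f g k → convolve f g (suc k) ≈ f (suc k) * g 0 + convolve f (g ∘ suc) k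
  convolve-sucʳ f g zero    = solve 4 (λ a b c d → a :* b :+ (c :* d :+ con 0ℤ) := c :* d :+ (a :* b :+ con 0ℤ)) refl _ _ _ _
  convolve-sucʳ f g (suc k) = begin
    f 0 * g (2 ℕ.+ k) + convolve (f ∘ suc) g (suc k)
      ≈⟨ +-congˡ (convolve-sucʳ (f ∘ suc) g k) ⟩
    f 0 * g (2 ℕ.+ k) + (f (2 ℕ.+ k) * g 0 + convolve (f ∘ suc) (g ∘ suc) k)
      ≈⟨ solve 3 (λ a b c → a :+ (b :+ c) := b :+ (a :+ c)) refl _ _ _ ⟩
    f (2 ℕ.+ k) * g 0 + (f 0 * g (2 ℕ.+ k) + convolve (f ∘ suc) (g ∘ suc) k) ∎

  convolve-comm : ∀ f g k → convolve f g k ≈ convolve g f k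
  convolve-comm f g zero    = +-congʳ (*-comm _ _)
  convolve-comm f g (suc k) = begin
    f 0 * g (suc k) + convolve (f ∘ suc) g k  ≈⟨ +-cong (*-comm _ _) (convolve-comm (f ∘ suc) g k) ⟩
    g (suc k) * f 0 + convolve g (f ∘ suc) k  ≈⟨ convolve-sucʳ g f k ⟨
    convolve g f (suc k)                      ∎

  convolve-distribʳ : ∀ f g h k → convolve (g ⊕ h) f k ≈ convolve g f k + convolve h f k
  convolve-distribʳ f g h zero    = solve 3 (λ f g h → (g :+ h) :* f :+ con 0ℤ := (g :* f :+ con 0ℤ) :+ (h :* f :+ con 0ℤ)) refl _ _ _
  convolve-distribʳ f g h (suc k) = begin
    (g 0 + h 0) * f (suc k) + convolve ((g ∘ suc) ⊕ (h ∘ suc)) f k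
      ≈⟨ +-congˡ (convolve-distribʳ f (g ∘ suc) (h ∘ suc) k) ⟩
    (g 0 + h 0) * f (suc k) + (convolve (g ∘ suc) f k + convolve (h ∘ suc) f k)
      ≈⟨ solve 5 (λ g h f a b → (g :+ h) :* f :+ (a :+ b) := (g :* f :+ a) :+ (h :* f :+ b)) refl _ _ _ _ _ ⟩
    convolve g f (suc k) + convolve h f (suc k) ∎

  convolve-scale : ∀ a f g k → convolve (λ j → a * f j) g k ≈ a * convolve f g k
  convolve-scale a f g k = trans (sum-cong-≋ {suc k} λ j → *-assoc a (f (toℕ j)) (g (k ∸ toℕ j)))
    (sym (*-distribˡ-sum {suc k} a λ j → f (toℕ j) * g (k ∸ toℕ j)))
    where open import Algebra.Properties.Semiring.Sum semiring using (*-distribˡ-sum)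

  convolve-assoc : ∀ f g h k → convolve (convolve f g) h k ≈ convolve f (convolve g h) k
  convolve-assoc f g h zero    = solve 3 (λ f g h → (f :* g :+ con 0ℤ) :* h :+ con 0ℤ := f :* (g :* h :+ con 0ℤ) :+ con 0ℤ) refl _ _ _
  convolve-assoc f g h (suc k) = begin
    -- The tail of `convolve f g` is by definition `f 0` times the tail of `g` plus
    -- `convolve (f ∘ suc) g`, so the induction shifts `f`.
    (f 0 * g 0 + 0#) * h (suc k) + convolve ((λ j → f 0 * g (suc j)) ⊕ convolve (f ∘ suc) g) h k
      ≈⟨ +-congˡ (convolve-distribʳ h (λ j → f 0 * g (suc j)) (convolve (f ∘ suc) g) k) ⟩
    (f 0 * g 0 + 0#) * h (suc k) + (convolve (λ j → f 0 * g (suc j)) h k + convolve (convolve (f ∘ suc) g) h k)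
      ≈⟨ +-congˡ (+-cong (convolve-scale (f 0) (g ∘ suc) h k) (convolve-assoc (f ∘ suc) g h k)) ⟩
    (f 0 * g 0 + 0#) * h (suc k) + (f 0 * convolve (g ∘ suc) h k + convolve (f ∘ suc) (convolve g h) k)
      ≈⟨ solve 5 (λ f g h a b → (f :* g :+ con 0ℤ) :* h :+ (f :* a :+ b) := f :* (g :* h :+ a) :+ b) refl _ _ _ _ _ ⟩
    convolve f (convolve g h) (suc k) ∎

  opaque
    infixl 7 _⊛_
    _⊛_ : Series → Series → Series
    _⊛_ = convolve

    ⊛-at : ∀ f g k → (f ⊛ g) k ≈ convolve f g k
    ⊛-at f g k = refl

    ⊛-cong : ∀ {f f′ g g′} → f ≋ f′ → g ≋ g′ → f ⊛ g ≋ f′ ⊛ g′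
    ⊛-cong p q = pointwise λ k → convolve-cong k (at p) (at q)

    ⊛-comm : ∀ f g → f ⊛ g ≋ g ⊛ f
    ⊛-comm f g = pointwise (convolve-comm f g)

    ⊛-assoc : ∀ f g h → (f ⊛ g) ⊛ h ≋ f ⊛ (g ⊛ h)
    ⊛-assoc f g h = pointwise (convolve-assoc f g h)

    ⊛-identityˡ : ∀ f → const 1# ⊛ f ≋ f
    ⊛-identityˡ f = pointwise λ k → trans (convolve-const 1# f k) (*-identityˡ _)

    ⊛-distribʳ : ∀ f g h → (g ⊕ h) ⊛ f ≋ (g ⊛ f) ⊕ (h ⊛ f)
    ⊛-distribʳ f g h = pointwise (convolve-distribʳ f g h)

  seriesRing : CommutativeRing c ℓ₁
  seriesRing = record
    { Carrier = Series
    ; _≈_ = _≋_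
    ; _+_ = _⊕_
    ; _*_ = _⊛_
    ; -_ = ⊖_
    ; 0# = 0ˢ
    ; 1# = const 1#
    ; isCommutativeRing = record
      { isRing = record
        { +-isAbelianGroup = record
          { isGroup = record
            { isMonoid = record
              { isSemigroup = record
                { isMagma = record
                  { isEquivalence = record
                    { refl  = pointwise λ k → refl
                    ; sym   = λ p → pointwise λ k → sym (at p k)
                    ; trans = λ p q → pointwise λ k → trans (at p k) (at q k)
                    }
                  ; ∙-cong = λ p q → pointwise λ k → +-cong (at p k) (at q k)
                  }
                ; assoc = λ f g h → pointwise λ k → +-assoc _ _ _
                }
              ; identity = (λ f → pointwise λ k → +-identityˡ _) , (λ f → pointwise λ k → +-identityʳ _)
              }
            ; inverse = (λ f → pointwise λ k → -‿inverseˡ _) , (λ f → pointwise λ k → -‿inverseʳ _)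
            ; ⁻¹-cong = λ p → pointwise λ k → -‿cong (at p k)
            }
          ; comm = λ f g → pointwise λ k → +-comm _ _
          }
        ; *-cong = ⊛-cong
        ; *-assoc = ⊛-assoc
        ; *-identity = ⊛-identityˡ , (λ f → pointwise λ k → trans (at (⊛-comm f _) k) (at (⊛-identityˡ f) k))
        ; distrib = (λ f g h → pointwise λ k → trans (at (⊛-comm f _) k)
                      (trans (at (⊛-distribʳ f g h) k) (+-cong (at (⊛-comm g f) k) (at (⊛-comm h f) k))))
                  , ⊛-distribʳ
        }
      ; *-comm = ⊛-comm
      }
    }
    where open Product using (_,_)

  ⊛-at-0 : ∀ f g → (f ⊛ g) 0 ≈ f 0 * g 0
  ⊛-at-0 f g = trans (⊛-at f g 0) (convolve-0 f g)

  const-⊛ : ∀ a f k → (const a ⊛ f) k ≈ a * f k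
  const-⊛ a f k = trans (⊛-at (const a) f k) (convolve-const a f k)

  ⊛≈Σ : ∀ f g k → (f ⊛ g) k ≈ Σ (suc k) (λ j → f j * g (k ∸ j))
  ⊛≈Σ f g k = trans (⊛-at f g k) (rangeSum≈Σ 0 k _)

  module S where
    open CommutativeRing seriesRing public hiding (zero)
    open FiniteSums seriesRing public
    open ElementarySymmetric seriesRing public

  const-isHom : RingMorphisms.IsRingHomomorphism rawRing S.rawRing const
  const-isHom = record
    { isSemiringHomomorphism = record
      { isNearSemiringHomomorphism = record
        { +-isMonoidHomomorphism = record
          { isMagmaHomomorphism = record
            { isRelHomomorphism = record { cong = λ eq → pointwise λ { zero → eq ; (suc k) → refl } }
            ; homo = λ a b → pointwise λ { zero → refl ; (suc k) → sym (+-identityʳ 0#) }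
            }
          ; ε-homo = pointwise λ { zero → refl ; (suc k) → refl }
          }
        ; *-homo = λ a b → pointwise λ { zero → sym (const-⊛ a (const b) zero)
                                       ; (suc k) → sym (trans (const-⊛ a (const b) (suc k)) (zeroʳ a)) }
        }
      ; 1#-homo = S.refl
      }
    ; -‿homo = λ a → pointwise λ { zero → refl ; (suc k) → sym -0#≈0# }
    }

  evaluation-isHom : RingMorphisms.IsRingHomomorphism S.rawRing rawRing (λ f → f 0)
  evaluation-isHom = record
    { isSemiringHomomorphism = record
      { isNearSemiringHomomorphism = record
        { +-isMonoidHomomorphism = record
          { isMagmaHomomorphism = record
            { isRelHomomorphism = record { cong = λ eq → at eq 0 }
            ; homo = λ f g → refl
            }
          ; ε-homo = refl
          }
        ; *-homo = ⊛-at-0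
        }
      ; 1#-homo = refl
      }
    ; -‿homo = λ f → refl
    }

  module Const = Homomorphism fieldRing seriesRing const-isHom
  module Evaluation = Homomorphism seriesRing fieldRing evaluation-isHom

  Σ-at : ∀ n F k → S.Σ n F k ≈ Σ n (λ p → F p k)
  Σ-at zero    F k = trans (at (S.Σ-0 F) k) (sym (Σ-0 _))
  Σ-at (suc n) F k = trans (at (S.Σ-suc n F) k) (trans (+-congˡ (Σ-at n (F ∘ suc) k)) (sym (Σ-suc n _)))

  -- The substitution t ↦ -t.
  reflect : Series → Series
  reflect f k = sign k * f k

  sign-+ : ∀ j k → sign (j ℕ.+ k) ≈ sign j * sign k
  sign-+ j k = ^-homo-* (- 1#) j k

  reflect-isHom : RingMorphisms.IsRingHomomorphism S.rawRing S.rawRing reflect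
  reflect-isHom = record
    { isSemiringHomomorphism = record
      { isNearSemiringHomomorphism = record
        { +-isMonoidHomomorphism = record
          { isMagmaHomomorphism = record
            { isRelHomomorphism = record { cong = λ eq → pointwise λ k → *-congˡ (at eq k) }
            ; homo = λ f g → pointwise λ k → distribˡ _ _ _
            }
          ; ε-homo = pointwise λ k → zeroʳ _
          }
        ; *-homo = λ f g → pointwise (homo f g)
        }
      ; 1#-homo = pointwise λ { zero → *-identityˡ 1# ; (suc k) → zeroʳ _ }
      }
    ; -‿homo = λ f → pointwise λ k → solve 2 (λ a b → a :* (:- b) := :- (a :* b)) refl _ _
    }
    where
    homo : ∀ f g k → sign k * (f ⊛ g) k ≈ (reflect f ⊛ reflect g) k
    homo f g k = begin
      sign k * (f ⊛ g) k                                  ≈⟨ *-congˡ (⊛≈Σ f g k) ⟩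
      sign k * Σ (suc k) (λ j → f j * g (k ∸ j))          ≈⟨ Σ-distribˡ (suc k) _ _ ⟩
      Σ (suc k) (λ j → sign k * (f j * g (k ∸ j)))        ≈⟨ Σ-cong (suc k) (λ j j<1+k → begin
          sign k * (f j * g (k ∸ j))                  ≡⟨ ≡.cong (λ i → sign i * (f j * g (k ∸ j))) (ℕ.m+[n∸m]≡n (ℕ.s≤s⁻¹ j<1+k)) ⟨
          sign (j ℕ.+ (k ∸ j)) * (f j * g (k ∸ j))    ≈⟨ *-congʳ (sign-+ j (k ∸ j)) ⟩
          sign j * sign (k ∸ j) * (f j * g (k ∸ j))   ≈⟨ solve 4 (λ s s′ a b → s :* s′ :* (a :* b) := s :* a :* (s′ :* b)) refl (sign j) (sign (k ∸ j)) _ _ ⟩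
          sign j * f j * (sign (k ∸ j) * g (k ∸ j))   ∎) ⟩
      Σ (suc k) (λ j → reflect f j * reflect g (k ∸ j))   ≈⟨ ⊛≈Σ (reflect f) (reflect g) k ⟨
      (reflect f ⊛ reflect g) k ∎

  T : Series
  T zero    = 0#
  T (suc k) = const 1# k

  T*-0 : ∀ f → (T S.* f) 0 ≈ 0#
  T*-0 f = trans (⊛-at-0 T f) (zeroˡ _)

  T*-suc : ∀ f k → (T S.* f) (suc k) ≈ f k
  T*-suc f k = trans (⊛-at T f (suc k)) (trans (+-cong (zeroˡ _) (trans (convolve-const 1# f k) (*-identityˡ _))) (+-identityˡ _))

  T-cancel : ∀ {f g} → T S.* f ≋ T S.* g → f ≋ g
  T-cancel {f} {g} eq = pointwise λ k → trans (sym (T*-suc f k)) (trans (at eq (suc k)) (T*-suc g k))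

  T^*-at : ∀ p f k → ((T S.^ p) S.* f) (p ℕ.+ k) ≈ f k
  T^*-at zero    f k = at (S.*-identityˡ f) k
  T^*-at (suc p) f k = trans (at (S.*-assoc T (T S.^ p) f) (suc (p ℕ.+ k)))
    (trans (T*-suc ((T S.^ p) S.* f) (p ℕ.+ k)) (T^*-at p f k))

  T^-cancel : ∀ p {f g} → (T S.^ p) S.* f ≋ (T S.^ p) S.* g → f ≋ g
  T^-cancel p {f} {g} eq = pointwise λ k → trans (sym (T^*-at p f k)) (trans (at eq (p ℕ.+ k)) (T^*-at p g k))

  factor-T^ : ∀ p f → (∀ {k} → k ℕ.< p → f k ≈ 0#) → f ≋ (T S.^ p) S.* (λ k → f (k ℕ.+ p))
  factor-T^ zero    f _   = S.trans (pointwise λ k → reflexive (≡.cong f (≡.sym (ℕ.+-identityʳ k)))) (S.sym (S.*-identityˡ _))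
  factor-T^ (suc p) f f≈0 = S.trans (pointwise head≈) (S.trans (S.*-congˡ (factor-T^ p (f ∘ suc) λ k<p → f≈0 (s≤s k<p)))
    (S.trans (S.sym (S.*-assoc T (T S.^ p) _)) (S.*-congˡ (pointwise λ k → reflexive (≡.cong f (≡.sym (ℕ.+-suc k p)))))))
    where
    head≈ : ∀ k → f k ≈ (T S.* (f ∘ suc)) k
    head≈ zero    = trans (f≈0 (s≤s z≤n)) (sym (T*-0 (f ∘ suc)))
    head≈ (suc k) = sym (T*-suc (f ∘ suc) k)

  lookup-reciprocals : ∀ u r k (j : Fin (suc k)) → Vec.lookup (reciprocals u r k) j ≡ reciprocal u r (k ∸ toℕ j)
  lookup-reciprocals u r zero    Fin.zero    = ≡.refl
  lookup-reciprocals u r (suc k) Fin.zero    = ≡.refl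
  lookup-reciprocals u r (suc k) (Fin.suc j) = lookup-reciprocals u r k j

  -- The recursion in `reciprocals` is u₀ v_{k+1} + u₁ v_k + ... + u_{k+1} v₀ = 0 solved for
  -- v_{k+1}, and the left side is a coefficient of the product.
  reciprocal-inverse : ∀ u r → u 0 * r ≈ 1# → u S.* reciprocal u r ≋ S.1#
  reciprocal-inverse u r ur≈1 = pointwise λ
    { zero    → trans (⊛-at-0 u (reciprocal u r)) ur≈1
    ; (suc k) → trans (⊛-at u (reciprocal u r) (suc k)) (begin
        u 0 * (- (r * sum (λ j → u (suc (toℕ j)) * Vec.lookup (reciprocals u r k) j))) + convolve (u ∘ suc) (reciprocal u r) k
          ≈⟨ +-congʳ (*-congˡ (-‿cong (*-congˡ (sum-cong-≋ {suc k} λ j → *-congˡ {x = u (suc (toℕ j))} (reflexive (lookup-reciprocals u r k j)))))) ⟩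
        u 0 * (- (r * convolve (u ∘ suc) (reciprocal u r) k)) + convolve (u ∘ suc) (reciprocal u r) k
          ≈⟨ solve 3 (λ a r x → a :* (:- (r :* x)) :+ x := (con 1ℤ :- a :* r) :* x) refl (u 0) r _ ⟩
        (1# - u 0 * r) * convolve (u ∘ suc) (reciprocal u r) k
          ≈⟨ *-congʳ (trans (+-congˡ (-‿cong ur≈1)) (-‿inverseʳ 1#)) ⟩
        0# * convolve (u ∘ suc) (reciprocal u r) k
          ≈⟨ zeroˡ _ ⟩
        0# ∎)
    }

  exp : Carrier → Series
  exp y = coeff exp[t y ]

  exp-cong : ∀ {y z} → y ≈ z → exp y ≋ exp z
  exp-cong y≈z = pointwise λ k → *-congʳ (^-congˡ k y≈z)

  factorial-inverse : ∀ k → ((k !) × 1#) * 1/ k ! ≈ 1#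
  factorial-inverse k = recip-inverseʳ _ _

  1/0!≈1 : 1/ 0 ! ≈ 1#
  1/0!≈1 = trans (sym (*-identityˡ _)) (trans (*-congʳ (sym (×-homo-1 1#))) (factorial-inverse 0))

  1/1!≈1 : 1/ 1 ! ≈ 1#
  1/1!≈1 = trans (sym (*-identityˡ _)) (trans (*-congʳ (sym (×-homo-1 1#))) (factorial-inverse 1))

  exp-at-0 : ∀ y → exp y 0 ≈ 1#
  exp-at-0 y = trans (*-identityˡ _) 1/0!≈1

  exp-at-1 : ∀ y → exp y 1 ≈ y
  exp-at-1 y = trans (*-cong (*-identityʳ y) 1/1!≈1) (*-identityʳ y)

  exp-0 : exp 0# ≋ S.1#
  exp-0 = pointwise λ { zero → exp-at-0 0# ; (suc k) → trans (*-congʳ (zeroˡ _)) (zeroˡ _) }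

  C-factorial : ∀ {j k} → j ℕ.≤ k → ((k C j) × 1#) * 1/ k ! ≈ 1/ j ! * 1/ (k ∸ j) !
  C-factorial {j} {k} j≤k = begin
    d * x                                ≈⟨ solve 2 (λ d x → d :* x := d :* x :* con 1ℤ :* con 1ℤ) refl d x ⟩
    -- The inserted factors j!/j! and (k - j)!/(k - j)! complete the binomial coefficient to k!,
    -- which cancels `1/ k !`.
    d * x * 1# * 1#                      ≈⟨ *-cong (*-congˡ (factorial-inverse j)) (factorial-inverse (k ∸ j)) ⟨
    d * x * (a * a′) * (b * b′)          ≈⟨ solve 6 (λ d x a a′ b b′ → d :* x :* (a :* a′) :* (b :* b′) := d :* (a :* b) :* x :* (a′ :* b′)) refl d x a a′ b b′ ⟩
    d * (a * b) * x * (a′ * b′)          ≈⟨ *-congʳ (trans (*-congʳ cab≈k!) (factorial-inverse k)) ⟩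
    1# * (a′ * b′)                       ≈⟨ *-identityˡ _ ⟩
    a′ * b′                              ∎
    where
    d x a a′ b b′ : Carrier
    d = (k C j) × 1#
    x = 1/ k !
    a = (j !) × 1#
    a′ = 1/ j !
    b = ((k ∸ j) !) × 1#
    b′ = 1/ (k ∸ j) !
    instance
      j![k∸j]!≢0 : ℕ.NonZero (j ! ℕ.* (k ∸ j) !)
      j![k∸j]!≢0 = j ℕ.!* (k ∸ j) !≢0

    cab≡k! : (k C j) ℕ.* (j ! ℕ.* (k ∸ j) !) ≡ k !
    cab≡k! = ≡.trans (≡.cong (ℕ._* (j ! ℕ.* (k ∸ j) !)) (nCk≡n!/k![n-k]! j≤k)) (ℕ.m/n*n≡m (k![n∸k]!∣n! j≤k))

    cab≈k! : d * (a * b) ≈ (k !) × 1#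
    cab≈k! = begin
      d * (a * b)                                  ≈⟨ *-congˡ (×1-homo-* (j !) ((k ∸ j) !)) ⟨
      d * ((j ! ℕ.* (k ∸ j) !) × 1#)               ≈⟨ ×1-homo-* (k C j) (j ! ℕ.* (k ∸ j) !) ⟨
      ((k C j) ℕ.* (j ! ℕ.* (k ∸ j) !)) × 1#       ≡⟨ ≡.cong (_× 1#) cab≡k! ⟩
      (k !) × 1#                                   ∎

  opaque
    unfolding Σ
    binomial-theorem : ∀ k x y → (x + y) ^ k ≈ Σ (suc k) (λ j → (k C j) × (x ^ j * y ^ (k ∸ j)))
    binomial-theorem k x y = Binomial.theorem k x y
      where import Algebra.Properties.CommutativeSemiring.Binomial commutativeSemiring as Binomial

  exp-+ : ∀ x y → exp (x + y) ≋ exp x S.* exp y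
  exp-+ x y = pointwise λ k → begin
    (x + y) ^ k * 1/ k !
      ≈⟨ trans (*-congʳ (binomial-theorem k x y)) (trans (*-comm _ _) (Σ-distribˡ (suc k) _ _)) ⟩
    Σ (suc k) (λ j → 1/ k ! * ((k C j) × (x ^ j * y ^ (k ∸ j))))
      ≈⟨ Σ-cong (suc k) (λ j j<1+k → begin
           1/ k ! * ((k C j) × (x ^ j * y ^ (k ∸ j)))
             ≈⟨ *-congˡ (×≈×1* (k C j) _) ⟩
           1/ k ! * ((k C j) × 1# * (x ^ j * y ^ (k ∸ j)))
             ≈⟨ solve 4 (λ r c a b → r :* (c :* (a :* b)) := c :* r :* (a :* b)) refl _ _ _ _ ⟩
           ((k C j) × 1#) * 1/ k ! * (x ^ j * y ^ (k ∸ j))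
             ≈⟨ *-congʳ (C-factorial (ℕ.s≤s⁻¹ j<1+k)) ⟩
           1/ j ! * 1/ (k ∸ j) ! * (x ^ j * y ^ (k ∸ j))
             ≈⟨ solve 4 (λ r c a b → r :* c :* (a :* b) := a :* r :* (b :* c)) refl _ _ _ _ ⟩
           x ^ j * 1/ j ! * (y ^ (k ∸ j) * 1/ (k ∸ j) !) ∎) ⟩
    Σ (suc k) (λ j → exp x j * exp y (k ∸ j))
      ≈⟨ ⊛≈Σ (exp x) (exp y) k ⟨
    (exp x S.* exp y) k ∎

  exp-^ : ∀ y j → exp y S.^ j ≋ exp (j × y)
  exp-^ y zero    = S.sym exp-0
  exp-^ y (suc j) = S.trans (S.*-congˡ (exp-^ y j)) (S.sym (exp-+ y (j × y)))

  exp-neg : ∀ y → exp (- y) S.* exp y ≋ S.1#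
  exp-neg y = S.trans (S.sym (exp-+ (- y) y)) (S.trans (exp-cong (-‿inverseˡ y)) exp-0)

  reflect-exp : ∀ y → reflect (exp y) ≋ exp (- y)
  reflect-exp y = pointwise λ k → begin
    sign k * (y ^ k * 1/ k !)   ≈⟨ *-assoc _ _ _ ⟨
    sign k * y ^ k * 1/ k !     ≈⟨ *-congʳ (^-distrib-* (- 1#) y k) ⟨
    (- 1# * y) ^ k * 1/ k !     ≈⟨ *-congʳ (^-congˡ k (-1*x≈-x y)) ⟩
    (- y) ^ k * 1/ k !          ∎

  reflect-T : reflect T ≋ S.- T
  reflect-T = pointwise λ
    { zero          → trans (zeroʳ _) (sym -0#≈0#)
    ; (suc zero)    → trans (*-identityʳ _) (*-identityʳ _)
    ; (suc (suc k)) → trans (zeroʳ _) (sym -0#≈0#)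
    }

-- Lists of subsets, split by membership of the first index.

module _ {a p} {A : Set a} {P : Pred A p} (P? : Decidable P) where

  filter-map : ∀ {b} {B : Set b} (f : B → A) xs → filter P? (map f xs) ≡ map f (filter (P? ∘ f) xs)
  filter-map f []       = ≡.refl
  filter-map f (x ∷ xs) with does (P? (f x))
  ... | true  = ≡.cong (f x ∷_) (filter-map f xs)
  ... | false = filter-map f xs

  -- `filter` depends only on the Boolean answers. In the applications these agree by `refl`,
  -- because `_∈?_` past the first entry and `_≟_` on successors reduce to the smaller decision.
  filter-does : ∀ {q} {Q : Pred A q} (Q? : Decidable Q) → (∀ x → does (P? x) ≡ does (Q? x)) →
                ∀ xs → filter P? xs ≡ filter Q? xs
  filter-does Q? eq []       = ≡.refl
  filter-does Q? eq (x ∷ xs) with does (P? x) | does (Q? x) | eq x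
  ... | true  | .true  | ≡.refl = ≡.cong (x ∷_) (filter-does Q? eq xs)
  ... | false | .false | ≡.refl = filter-does Q? eq xs

elements-tail : ∀ {n} b (J : Subset n) → filter (_∈? (b Vec.∷ J)) (tabulate Fin.suc) ≡ map Fin.suc (elements J)
elements-tail b J = ≡.trans (≡.cong (filter (_∈? (b Vec.∷ J))) (≡.sym (map-tabulate id Fin.suc)))
  (≡.trans (filter-map (_∈? (b Vec.∷ J)) Fin.suc (allFin _))
    (≡.cong (map Fin.suc) (filter-does (λ i → Fin.suc i ∈? (b Vec.∷ J)) (_∈? J) (λ i → ≡.refl) (allFin _))))

elements-outside : ∀ {n} (J : Subset n) → elements (outside Vec.∷ J) ≡ map Fin.suc (elements J)
elements-outside J = elements-tail outside J

elements-inside : ∀ {n} (J : Subset n) → elements (inside Vec.∷ J) ≡ Fin.zero ∷ map Fin.suc (elements J)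
elements-inside J = ≡.cong (Fin.zero ∷_) (elements-tail inside J)

length-elements : ∀ {n} (J : Subset n) → length (elements J) ≡ ∣ J ∣
length-elements Vec.[]              = ≡.refl
length-elements (outside Vec.∷ J) = ≡.trans (≡.cong length (elements-outside J))
  (≡.trans (length-map Fin.suc (elements J)) (length-elements J))
length-elements (inside Vec.∷ J)  = ≡.trans (≡.cong length (elements-inside J))
  (≡.cong suc (≡.trans (length-map Fin.suc (elements J)) (length-elements J)))

subsetsOfSize-zero : ∀ n → subsetsOfSize (suc n) 0 ≡ map (outside Vec.∷_) (subsetsOfSize n 0)
subsetsOfSize-zero n = begin
  filter size? (map (outside Vec.∷_) (subsets n) ++ map (inside Vec.∷_) (subsets n))
    ≡⟨ filter-++ size? (map (outside Vec.∷_) (subsets n)) _ ⟩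
  filter size? (map (outside Vec.∷_) (subsets n)) ++ filter size? (map (inside Vec.∷_) (subsets n))
    ≡⟨ ≡.cong₂ _++_ (filter-map size? (outside Vec.∷_) (subsets n)) (filter-map size? (inside Vec.∷_) (subsets n)) ⟩
  map (outside Vec.∷_) (subsetsOfSize n 0) ++ map (inside Vec.∷_) (filter (size? ∘ (inside Vec.∷_)) (subsets n))
    ≡⟨ ≡.cong (λ Js → map (outside Vec.∷_) (subsetsOfSize n 0) ++ map (inside Vec.∷_) Js)
         (filter-none (size? ∘ (inside Vec.∷_)) (All.universal (λ _ ()) (subsets n))) ⟩
  map (outside Vec.∷_) (subsetsOfSize n 0) ++ []
    ≡⟨ ++-identityʳ _ ⟩
  map (outside Vec.∷_) (subsetsOfSize n 0) ∎
  where
  open ≡.≡-Reasoning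
  size? : Decidable (λ (J : Subset (suc n)) → ∣ J ∣ ≡ 0)
  size? J = ∣ J ∣ ℕ.≟ 0

subsetsOfSize-suc : ∀ n p → subsetsOfSize (suc n) (suc p) ≡
                    map (outside Vec.∷_) (subsetsOfSize n (suc p)) ++ map (inside Vec.∷_) (subsetsOfSize n p)
subsetsOfSize-suc n p = begin
  filter size? (map (outside Vec.∷_) (subsets n) ++ map (inside Vec.∷_) (subsets n))
    ≡⟨ filter-++ size? (map (outside Vec.∷_) (subsets n)) _ ⟩
  filter size? (map (outside Vec.∷_) (subsets n)) ++ filter size? (map (inside Vec.∷_) (subsets n))
    ≡⟨ ≡.cong₂ _++_ (filter-map size? (outside Vec.∷_) (subsets n)) (filter-map size? (inside Vec.∷_) (subsets n)) ⟩
  map (outside Vec.∷_) (subsetsOfSize n (suc p)) ++ map (inside Vec.∷_) (filter (size? ∘ (inside Vec.∷_)) (subsets n))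
    ≡⟨ ≡.cong (λ Js → map (outside Vec.∷_) (subsetsOfSize n (suc p)) ++ map (inside Vec.∷_) Js)
         (filter-does (size? ∘ (inside Vec.∷_)) (λ J → ∣ J ∣ ℕ.≟ p) (λ J → ≡.refl) (subsets n)) ⟩
  map (outside Vec.∷_) (subsetsOfSize n (suc p)) ++ map (inside Vec.∷_) (subsetsOfSize n p) ∎
  where
  open ≡.≡-Reasoning
  size? : Decidable (λ (J : Subset (suc n)) → ∣ J ∣ ≡ suc p)
  size? J = ∣ J ∣ ℕ.≟ suc p

-- Elementary symmetric functions as sums over subsets.

module ListSums {c ℓ} (R : CommutativeRing c ℓ) where

  open CommutativeRing R hiding (zero)
  open ElementarySymmetric R
  open import Relation.Binary.Reasoning.Setoid setoid

  listSum listProduct : ∀ {a} {A : Set a} → List A → (A → Carrier) → Carrier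
  listSum     xs f = foldr (λ x y → f x + y) 0# xs
  listProduct xs f = foldr (λ x y → f x * y) 1# xs

  listSum-cong : ∀ {a} {A : Set a} {xs : List A} {f g} → All (λ x → f x ≈ g x) xs → listSum xs f ≈ listSum xs g
  listSum-cong []           = refl
  listSum-cong (fx≈gx ∷ ps) = +-cong fx≈gx (listSum-cong ps)

  listSum-++ : ∀ {a} {A : Set a} (xs ys : List A) f → listSum (xs ++ ys) f ≈ listSum xs f + listSum ys f
  listSum-++ []       ys f = sym (+-identityˡ _)
  listSum-++ (x ∷ xs) ys f = trans (+-congˡ (listSum-++ xs ys f)) (sym (+-assoc _ _ _))

  listSum-map : ∀ {a b} {A : Set a} {B : Set b} (g : A → B) xs f → listSum (map g xs) f ≡ listSum xs (f ∘ g)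
  listSum-map g []       f = ≡.refl
  listSum-map g (x ∷ xs) f = ≡.cong (λ y → f (g x) + y) (listSum-map g xs f)

  listProduct-map : ∀ {a b} {A : Set a} {B : Set b} (g : A → B) xs f → listProduct (map g xs) f ≡ listProduct xs (f ∘ g)
  listProduct-map g []       f = ≡.refl
  listProduct-map g (x ∷ xs) f = ≡.cong (f (g x) *_) (listProduct-map g xs f)

  listSum-*ˡ : ∀ {a} {A : Set a} x (xs : List A) f → listSum xs (λ j → x * f j) ≈ x * listSum xs f
  listSum-*ˡ x []       f = sym (zeroʳ x)
  listSum-*ˡ x (j ∷ xs) f = trans (+-congˡ (listSum-*ˡ x xs f)) (sym (distribˡ _ _ _))

  product-outside : ∀ {n} (v : Vector Carrier (suc n)) J →
                    listProduct (elements (outside Vec.∷ J)) v ≡ listProduct (elements J) (tail v)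
  product-outside v J = ≡.trans (≡.cong (λ js → listProduct js v) (elements-outside J)) (listProduct-map Fin.suc (elements J) v)

  product-inside : ∀ {n} (v : Vector Carrier (suc n)) J →
                   listProduct (elements (inside Vec.∷ J)) v ≡ head v * listProduct (elements J) (tail v)
  product-inside v J = ≡.trans (≡.cong (λ js → listProduct js v) (elements-inside J))
    (≡.cong (head v *_) (listProduct-map Fin.suc (elements J) v))

  -- Subsets omitting and subsets containing the first index correspond to the two summands in the
  -- recursion of `esym`.
  sum-subsetsOfSize : ∀ {n} (v : Vector Carrier n) p →
                      listSum (subsetsOfSize n p) (λ J → listProduct (elements J) v) ≈ esym v p
  sum-subsetsOfSize {zero}  v zero    = +-identityʳ 1#
  sum-subsetsOfSize {zero}  v (suc p) = refl
  sum-subsetsOfSize {suc n} v zero    = begin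
    listSum (subsetsOfSize (suc n) 0) f                            ≡⟨ ≡.cong (λ Js → listSum Js f) (subsetsOfSize-zero n) ⟩
    listSum (map (outside Vec.∷_) (subsetsOfSize n 0)) f           ≡⟨ listSum-map (outside Vec.∷_) (subsetsOfSize n 0) f ⟩
    listSum (subsetsOfSize n 0) (f ∘ (outside Vec.∷_))             ≈⟨ listSum-cong (All.universal (λ J → reflexive (product-outside v J)) (subsetsOfSize n 0)) ⟩
    listSum (subsetsOfSize n 0) (λ J → listProduct (elements J) (tail v))  ≈⟨ sum-subsetsOfSize (tail v) 0 ⟩
    esym (tail v) 0                                                ∎
    where
    f : Subset (suc n) → Carrier
    f J = listProduct (elements J) v
  sum-subsetsOfSize {suc n} v (suc p) = begin
    listSum (subsetsOfSize (suc n) (suc p)) f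
      ≡⟨ ≡.cong (λ Js → listSum Js f) (subsetsOfSize-suc n p) ⟩
    listSum (map (outside Vec.∷_) (subsetsOfSize n (suc p)) ++ map (inside Vec.∷_) (subsetsOfSize n p)) f
      ≈⟨ listSum-++ (map (outside Vec.∷_) (subsetsOfSize n (suc p))) _ f ⟩
    listSum (map (outside Vec.∷_) (subsetsOfSize n (suc p))) f + listSum (map (inside Vec.∷_) (subsetsOfSize n p)) f
      ≡⟨ ≡.cong₂ _+_ (listSum-map (outside Vec.∷_) (subsetsOfSize n (suc p)) f) (listSum-map (inside Vec.∷_) (subsetsOfSize n p) f) ⟩
    listSum (subsetsOfSize n (suc p)) (f ∘ (outside Vec.∷_)) + listSum (subsetsOfSize n p) (f ∘ (inside Vec.∷_))
      ≈⟨ +-cong (listSum-cong (All.universal (λ J → reflexive (product-outside v J)) (subsetsOfSize n (suc p))))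
                (listSum-cong (All.universal (λ J → reflexive (product-inside v J)) (subsetsOfSize n p))) ⟩
    listSum (subsetsOfSize n (suc p)) g + listSum (subsetsOfSize n p) (λ J → head v * g J)
      ≈⟨ +-cong (sum-subsetsOfSize (tail v) (suc p)) (trans (listSum-*ˡ (head v) (subsetsOfSize n p) g) (*-congˡ (sum-subsetsOfSize (tail v) p))) ⟩
    esym (tail v) (suc p) + head v * esym (tail v) p ∎
    where
    f : Subset (suc n) → Carrier
    f J = listProduct (elements J) v
    g : Subset n → Carrier
    g J = listProduct (elements J) (tail v)

-- Constant terms of Laurent series as coefficients of power series.

module ConstantTerms {c ℓ₁ ℓ₂} (K : HeytingField c ℓ₁ ℓ₂) (char0 : CharacteristicZero K) where

  open Series-in-t K char0 hiding (zero)
  open PowerSeries K char0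
  open ListSums fieldRing using (listSum; listSum-cong)
  open ListSums seriesRing using (listProduct; listSum-*ˡ; sum-subsetsOfSize) renaming (listSum to listSumˢ)
  open Leading
  open IntegerSolver seriesRing
  open import Relation.Binary.Reasoning.Setoid setoid

  delay-+ : ∀ d f k → delay d f (d ℕ.+ k) ≡ f k
  delay-+ zero    f k = ≡.refl
  delay-+ (suc d) f k = delay-+ d f k

  delay-0 : ∀ {d} → d ≡ 0 → ∀ f k → delay d f k ≡ f k
  delay-0 ≡.refl f k = ≡.refl

  -- `_+ᴸ_` adds the poles instead of taking their maximum; delaying each series by the pole of the
  -- other puts both constant terms at index `pole f + pole g`.
  constantTerm-+ᴸ : ∀ f g → constantTerm (f +ᴸ g) ≈ constantTerm f + constantTerm g
  constantTerm-+ᴸ f g = +-cong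
    (reflexive (≡.trans (≡.cong (delay (pole g) (coeff f)) (ℕ.+-comm (pole f) (pole g))) (delay-+ (pole g) (coeff f) (pole f))))
    (reflexive (delay-+ (pole f) (coeff g) (pole g)))

  constantTerm-sumᴸ : ∀ {a} {A : Set a} (xs : List A) f → constantTerm (sumᴸ xs f) ≈ listSum xs (λ x → constantTerm (f x))
  constantTerm-sumᴸ []       f = refl
  constantTerm-sumᴸ (x ∷ xs) f = trans (constantTerm-+ᴸ (f x) (sumᴸ xs f)) (+-congˡ (constantTerm-sumᴸ xs f))

  listSum-at : ∀ {a} {A : Set a} (xs : List A) f k → listSumˢ xs f k ≈ listSum xs (λ x → f x k)
  listSum-at []       f k = refl
  listSum-at (x ∷ xs) f k = +-congˡ (listSum-at xs f k)

  -- Covers -t xₐ and 1 - e^{t xₐ} together: both are power series with a simple zero at t = 0, and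
  -- `h a` is t divided by `g a`.
  module _ {n} (g : Fin n → Laurent) (pole≡0 : ∀ a → pole (g a) ≡ 0)
           (l : ∀ a → Leading (g a)) (position≡1 : ∀ a → position (l a) ≡ 1)
           (h : Vector Series n) (gh≋T : ∀ a → coeff (g a) S.* h a ≋ T) where

    pole-productᴸ : ∀ js → pole (productᴸ js g) ≡ 0
    pole-productᴸ []       = ≡.refl
    pole-productᴸ (j ∷ js) = ≡.cong₂ ℕ._+_ (pole≡0 j) (pole-productᴸ js)

    position-productᴸ : ∀ js → position (leading-product js g l) ≡ length js
    position-productᴸ []       = ≡.refl
    position-productᴸ (j ∷ js) = ≡.cong₂ ℕ._+_ (position≡1 j) (position-productᴸ js)

    coeff-productᴸ : ∀ js → coeff (productᴸ js g) S.* listProduct js h ≋ T S.^ length js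
    coeff-productᴸ []       = S.trans (S.*-identityʳ _) (pointwise λ { zero → refl ; (suc k) → refl })
    coeff-productᴸ (j ∷ js) = S.trans (S.*-congʳ {listProduct (j ∷ js) h} (pointwise λ k → sym (⊛-at (coeff (g j)) (coeff (productᴸ js g)) k)))
      (S.trans (solve 4 (λ a b x y → (a :* b) :* (x :* y) := (a :* x) :* (b :* y)) S.refl (coeff (g j)) (coeff (productᴸ js g)) (h j) (listProduct js h))
        (S.*-cong (gh≋T j) (coeff-productᴸ js)))

    -- The denominators over `js` multiply to t^{length js} times a unit whose inverse is ∏ hₐ. The
    -- quotient is thus e^{ty} ∏ hₐ divided by t^{length js}.
    constantTerm-divide : ∀ y js →
      constantTerm (divide exp[t y ] (productᴸ js g) (leading-product js g l)) ≈ (exp y S.* listProduct js h) (length js)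
    constantTerm-divide y js = begin
      convolve (exp y) (delay (pole G) v) (position L)
        ≈⟨ convolve-cong {f = exp y} (position L) (λ _ → refl) (λ k → trans (reflexive (delay-0 (pole-productᴸ js) v k)) (at v≋H k)) ⟩
      convolve (exp y) H (position L)
        ≈⟨ ⊛-at (exp y) H (position L) ⟨
      (exp y S.* H) (position L)
        ≡⟨ ≡.cong (exp y S.* H) (position-productᴸ js) ⟩
      (exp y S.* H) (length js) ∎
      where
      G = productᴸ js g
      L = leading-product js g l
      H = listProduct js h
      u v : Series
      u k = coeff G (k ℕ.+ position L)
      v = reciprocal u (recip (u 0) (lead#0 L))

      uH≋1 : u S.* H ≋ S.1#
      uH≋1 = T^-cancel (position L) (S.trans (S.sym (S.*-assoc (T S.^ position L) u H))
        (S.trans (S.*-congʳ (S.sym (factor-T^ (position L) (coeff G) (below L))))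
          (S.trans (coeff-productᴸ js) (S.trans (S.reflexive (≡.cong (T S.^_) (≡.sym (position-productᴸ js)))) (S.sym (S.*-identityʳ _))))))

      -- Uniqueness of inverses: v = (u H) v = (u v) H = H.
      v≋H : v ≋ H
      v≋H = S.trans (S.sym (S.*-identityˡ v)) (S.trans (S.*-congʳ (S.sym uH≋1))
        (S.trans (solve 3 (λ u H v → u :* H :* v := u :* v :* H) S.refl u H v)
          (S.trans (S.*-congʳ (reciprocal-inverse u _ (recip-inverseʳ _ _))) (S.*-identityˡ H))))
  
    constantTerm-subsets : ∀ p y →
      constantTerm (sumᴸ (subsetsOfSize n p) λ J → divide exp[t y ] (productᴸ (elements J) g) (leading-product (elements J) g l))
      ≈ (exp y S.* S.esym h p) p
    constantTerm-subsets p y = begin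
      constantTerm (sumᴸ (subsetsOfSize n p) quotient)
        ≈⟨ constantTerm-sumᴸ (subsetsOfSize n p) quotient ⟩
      listSum (subsetsOfSize n p) (λ J → constantTerm (quotient J))
        ≈⟨ listSum-cong (All.map (λ {J} ∣J∣≡p → trans (constantTerm-divide y (elements J))
             (reflexive (≡.cong (exp y S.* listProduct (elements J) h) (≡.trans (length-elements J) ∣J∣≡p))))
             (all-filter (λ J → ∣ J ∣ ℕ.≟ p) (subsets n))) ⟩
      listSum (subsetsOfSize n p) (λ J → (exp y S.* listProduct (elements J) h) p)
        ≈⟨ listSum-at (subsetsOfSize n p) _ p ⟨
      listSumˢ (subsetsOfSize n p) (λ J → exp y S.* listProduct (elements J) h) p
        ≈⟨ at (S.trans (listSum-*ˡ (exp y) (subsetsOfSize n p) _) (S.*-congˡ (sum-subsetsOfSize h p))) p ⟩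
      (exp y S.* S.esym h p) p ∎
      where
      quotient : Subset n → Laurent
      quotient J = divide exp[t y ] (productᴸ (elements J) g) (leading-product (elements J) g l)

-- Multiplication by z - 1, and the reflection of t / (1 - e).

module Differences {c ℓ} (R : CommutativeRing c ℓ) where

  open CommutativeRing R hiding (zero)
  open FiniteSums R
  open IntegerSolver R
  open import Relation.Binary.Reasoning.Setoid setoid

  -- The coefficients of (z - 1) times the polynomial with coefficients a.
  difference : (ℕ → Carrier) → ℕ → Carrier
  difference a zero    = - a 0
  difference a (suc j) = a j - a (suc j)

  -- Summation by parts: multiplying by z - 1 and then applying zʲ ↦ `f j` amounts to applying zʲ ↦
  -- `f (suc j) - f j`. The hypothesis on `a n` removes the boundary term.
  Σ-difference : ∀ n (f a : ℕ → Carrier) → a n ≈ 0# → Σ (suc n) (λ j → f j * difference a j) ≈ Σ n (λ j → (f (suc j) - f j) * a j)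
  Σ-difference n f a aₙ≈0 = begin
    Σ (suc n) (λ j → f j * difference a j)
      ≈⟨ Σ-suc n _ ⟩
    f 0 * - a 0 + Σ n (λ j → f (suc j) * (a j - a (suc j)))
      ≈⟨ +-congˡ (Σ-cong′ n λ j → solve 3 (λ f a b → f :* (a :- b) := f :* a :+ :- con 1ℤ :* (f :* b)) refl (f (suc j)) (a j) (a (suc j))) ⟩
    f 0 * - a 0 + Σ n (λ j → f (suc j) * a j + - 1# * (f (suc j) * a (suc j)))
      ≈⟨ +-congˡ (trans (Σ-distrib-+ n _ _) (+-congˡ (sym (Σ-distribˡ n (- 1#) (λ j → f (suc j) * a (suc j)))))) ⟩
    f 0 * - a 0 + (Σ n (λ j → f (suc j) * a j) + - 1# * Σ n (λ j → f (suc j) * a (suc j)))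
      ≈⟨ solve 4 (λ f a x y → f :* :- a :+ (x :+ :- con 1ℤ :* y) := x :+ :- con 1ℤ :* (f :* a :+ y)) refl (f 0) (a 0) _ _ ⟩
    Σ n (λ j → f (suc j) * a j) + - 1# * (f 0 * a 0 + Σ n (λ j → f (suc j) * a (suc j)))
      ≈⟨ +-congˡ (*-congˡ (trans (sym (Σ-suc n (λ j → f j * a j))) (trans (Σ-last n (λ j → f j * a j)) (trans (+-congˡ (trans (*-congˡ aₙ≈0) (zeroʳ _))) (+-identityʳ _))))) ⟩
    Σ n (λ j → f (suc j) * a j) + - 1# * Σ n (λ j → f j * a j)
      ≈⟨ +-congˡ (Σ-distribˡ n (- 1#) _) ⟩
    Σ n (λ j → f (suc j) * a j) + Σ n (λ j → - 1# * (f j * a j))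
      ≈⟨ Σ-distrib-+ n _ _ ⟨
    Σ n (λ j → f (suc j) * a j + - 1# * (f j * a j))
      ≈⟨ Σ-cong′ n (λ j → solve 3 (λ f g a → g :* a :+ :- con 1ℤ :* (f :* a) := (g :- f) :* a) refl (f j) (f (suc j)) (a j)) ⟩
    Σ n (λ j → (f (suc j) - f j) * a j) ∎

  -- With e′ = 1/e this is h′ = -t / (1 - 1/e) = e h = h - (1 - e) h = h - t. As 1 - e is not
  -- assumed invertible, t = (1 - e) h is multiplied in; for power series `T-cancel` removes it.
  reflected-quotient : ∀ {e e′ h h′ t} → e′ * e ≈ 1# → (1# - e) * h ≈ t → (1# - e′) * h′ ≈ - t → t * h′ ≈ t * (h - t)
  reflected-quotient {e} {e′} {h} {h′} {t} e′e≈1 dh≈t d′h′≈-t = begin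
    t * h′                               ≈⟨ *-congʳ dh≈t ⟨
    (1# - e) * h * h′                    ≈⟨ solve 4 (λ e e′ h h′ → (con 1ℤ :- e) :* h :* h′ := :- h :* e :* ((con 1ℤ :- e′) :* h′) :+ (con 1ℤ :- e′ :* e) :* h :* h′) refl e e′ h h′ ⟩
    - h * e * ((1# - e′) * h′) + (1# - e′ * e) * h * h′
                                         ≈⟨ +-cong (*-congˡ d′h′≈-t) (trans (*-assoc _ _ _) (trans (*-congʳ (trans (+-congˡ (-‿cong e′e≈1)) (-‿inverseʳ 1#))) (zeroˡ _))) ⟩
    - h * e * - t + 0#                   ≈⟨ solve 3 (λ e h t → :- h :* e :* :- t :+ con 0ℤ := t :* (h :- (con 1ℤ :- e) :* h)) refl e h t ⟩
    t * (h - (1# - e) * h)               ≈⟨ *-congˡ (+-congˡ (-‿cong dh≈t)) ⟩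
    t * (h - t)                          ∎

-- Folding about the midpoint and regrouping of the double sums.

module Identity {c ℓ₁ ℓ₂} (K : HeytingField c ℓ₁ ℓ₂) (char0 : CharacteristicZero K) where

  open Series-in-t K char0 hiding (zero)
  open PowerSeries K char0
  open FiniteSums fieldRing hiding (_×_; _^_; -0#≈0#)
  open ElementarySymmetric fieldRing using (sign; signedChoose; esym)
  open ConstantTerms K char0
  open IntegerSolver fieldRing
  open IntegerSolver seriesRing using ()
    renaming (solve to solveˢ; con to conˢ; _:=_ to _:≋_; _:+_ to _:⊕_; _:*_ to _:⊛_; _:-_ to _:⊝_; :-_ to :⊖_)
  open Differences seriesRing
  open import Relation.Binary.Reasoning.Setoid setoid
  open import Algebra.Properties.Ring ring using (-‿involutive)

  sign² : ∀ k → sign k * sign k ≈ 1#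
  sign² zero    = *-identityˡ 1#
  sign² (suc k) = trans (solve 1 (λ a → :- con 1ℤ :* a :* (:- con 1ℤ :* a) := a :* a) refl (sign k)) (sign² k)

  sign-even : ∀ k → sign (k ℕ.+ k) ≈ 1#
  sign-even k = trans (sign-+ k k) (sign² k)

  sign-congruent : ∀ {j k m} → j ℕ.+ k ≡ m ℕ.+ m → sign j ≈ sign k
  sign-congruent {j} {k} {m} j+k≡2m = begin
    sign j                        ≈⟨ *-identityʳ _ ⟨
    sign j * 1#                   ≈⟨ *-congˡ (sign² k) ⟨
    sign j * (sign k * sign k)    ≈⟨ *-assoc _ _ _ ⟨
    sign j * sign k * sign k      ≈⟨ *-congʳ (trans (sym (sign-+ j k)) (trans (reflexive (≡.cong sign j+k≡2m)) (sign-even m))) ⟩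
    1# * sign k                   ≈⟨ *-identityˡ _ ⟩
    sign k                        ∎

  sign-∸ : ∀ {m i} → i ℕ.≤ m → sign (m ∸ i) ≈ sign (m ℕ.+ i)
  sign-∸ {m} {i} i≤m = sign-congruent {m ∸ i} {m ℕ.+ i} {m} (≡.trans (≡.cong ((m ∸ i) ℕ.+_) (ℕ.+-comm m i))
    (≡.trans (≡.sym (ℕ.+-assoc (m ∸ i) i m)) (≡.cong (ℕ._+ m) (ℕ.m∸n+n≡m i≤m))))

  module _ (s : Carrier) (m : ℕ) where

    -- This is (m - j) s, kept as the sum of the exponents of e^{mst} and of the j-th power of
    -- exp(-st).
    exponent : ℕ → Carrier
    exponent j = m × s + j × (- s)

    exponent-odd : ∀ i j → i ℕ.+ j ≡ m ℕ.+ m → exponent i ≈ - exponent j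
    exponent-odd i j i+j≡2m = begin
      m × s + i × (- s)              ≈⟨ +-cong (×≈×1* m s) (×≈×1* i (- s)) ⟩
      M * s + I * - s                ≈⟨ solve 4 (λ M I J s → M :* s :+ I :* :- s := (M :+ M) :* s :- (I :+ J) :* s :- (M :* s :+ J :* :- s)) refl M I J s ⟩
      (M + M) * s - (I + J) * s - (M * s + J * - s)
                                     ≈⟨ +-congʳ (+-congˡ (-‿cong (*-congʳ (trans (sym (×-homo-+ 1# i j)) (trans (×-congˡ i+j≡2m) (×-homo-+ 1# m m)))))) ⟩
      (M + M) * s - (M + M) * s - (M * s + J * - s)
                                     ≈⟨ trans (+-congʳ (-‿inverseʳ _)) (+-identityˡ _) ⟩
      - (M * s + J * - s)            ≈⟨ -‿cong (+-cong (×≈×1* m s) (×≈×1* j (- s))) ⟨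
      - (m × s + j × (- s))          ∎
      where
      M I J : Carrier
      M = m × 1#
      I = i × 1#
      J = j × 1#

    exponent-upper : ∀ i → exponent (m ℕ.+ i) ≈ - (i × s)
    exponent-upper i = begin
      m × s + (m ℕ.+ i) × (- s)              ≈⟨ +-congˡ (×-homo-+ (- s) m i) ⟩
      m × s + (m × (- s) + i × (- s))        ≈⟨ +-cong (×≈×1* m s) (+-cong (×≈×1* m (- s)) (×≈×1* i (- s))) ⟩
      M * s + (M * - s + I * - s)            ≈⟨ solve 3 (λ M I s → M :* s :+ (M :* :- s :+ I :* :- s) := :- (I :* s)) refl M I s ⟩
      - (I * s)                              ≈⟨ -‿cong (×≈×1* i s) ⟨
      - (i × s)                              ∎
      where
      M I : Carrier
      M = m × 1#
      I = i × 1#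

    -- Under j ↦ 2m - j the factor j - m changes sign, the exponent is negated, and by hypothesis
    -- `A` absorbs that negation with another sign; so mirror terms agree. At j = m + i the exponent
    -- is -is, the argument of `CTB` in the theorem.
    fold : (A : ℕ → Carrier → Carrier) → (∀ j {y z} → y ≈ z → A j y ≈ A j z) →
           (∀ i j y → i ℕ.+ j ≡ m ℕ.+ m → A i y ≈ - A j (- y)) →
           Σ (suc (m ℕ.+ m)) (λ j → sign j * (j × 1# - m × 1#) * A j (exponent j)) ≈
           2 × Σ m (λ i → sign (m ∸ suc i) * (suc i × 1#) * A (m ℕ.+ suc i) (- (suc i × s)))
    fold A A-cong A-odd = trans (Σ-symmetric m symmetric middle) (×-congʳ 2 (Σ-cong m upper))
      where
      term : ℕ → Carrier
      term j = sign j * (j × 1# - m × 1#) * A j (exponent j)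

      symmetric : ∀ i j → i ℕ.+ j ≡ m ℕ.+ m → term i ≈ term j
      symmetric i j i+j≡2m = begin
        sign i * (I - M) * A i (exponent i)
          ≈⟨ *-cong (*-congʳ (sign-congruent {i} {j} {m} i+j≡2m)) (trans (A-odd i j _ i+j≡2m) (-‿cong (A-cong j (trans (-‿cong (exponent-odd i j i+j≡2m)) (-‿involutive _))))) ⟩
        sign j * (I - M) * - A j (exponent j)
          -- From i + j = 2m one has M - I = J - M. The solver cannot use that hypothesis, so the
          -- vanishing quantity (M + M) - (I + J) is first split off.
          ≈⟨ solve 5 (λ σ I J M a → σ :* (I :- M) :* :- a := σ :* (J :- M :+ (M :+ M) :- (I :+ J)) :* a) refl (sign j) I J M _ ⟩
        sign j * (J - M + (M + M) - (I + J)) * A j (exponent j)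
          ≈⟨ *-congʳ (*-congˡ (+-congˡ (-‿cong (trans (sym (×-homo-+ 1# i j)) (trans (×-congˡ i+j≡2m) (×-homo-+ 1# m m)))))) ⟩
        sign j * (J - M + (M + M) - (M + M)) * A j (exponent j)
          ≈⟨ *-congʳ (*-congˡ (trans (+-assoc _ _ _) (trans (+-congˡ (-‿inverseʳ _)) (+-identityʳ _)))) ⟩
        sign j * (J - M) * A j (exponent j) ∎
        where
        M I J : Carrier
        M = m × 1#
        I = i × 1#
        J = j × 1#

      middle : term m ≈ 0#
      middle = trans (*-congʳ (trans (*-congˡ (-‿inverseʳ _)) (zeroʳ _))) (zeroˡ _)

      upper : ∀ i → i ℕ.< m → term (m ℕ.+ suc i) ≈ sign (m ∸ suc i) * (suc i × 1#) * A (m ℕ.+ suc i) (- (suc i × s))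
      upper i i<m = *-cong (*-cong (sym (sign-∸ i<m)) (trans (+-congʳ (×-homo-+ 1# m (suc i)))
        (solve 2 (λ a b → a :+ b :- a := b) refl (m × 1#) (suc i × 1#)))) (A-cong _ (exponent-upper (suc i)))

  -- Reorders the double sums of the theorem; all added terms contain a vanishing binomial coefficient.
  regroup : ∀ m n L (σ ω : ℕ → Carrier) (b B : ℕ → ℕ → Carrier) → m ℕ.≤ suc n → suc n ∸ m ℕ.≤ L →
    (∀ p i → suc p ℕ.< m ℕ.+ i → b p i ≈ 0#) →
    rangeSum m n (λ p → sign p * rangeSum 1 (p ℕ.+ 1 ∸ m) (λ i → σ i * b p i * ω i * B p i)) ≈
    Σ L (λ i → σ (suc i) * ω (suc i) * Σ (suc n) (λ p → sign p * b p (suc i) * B p (suc i)))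
  regroup m n L σ ω b B m≤1+n 1+n∸m≤L b≈0 = begin
    rangeSum m n (λ p → sign p * rangeSum 1 (p ℕ.+ 1 ∸ m) (G p))
      ≈⟨ rangeSum≈Σ m n (λ p → sign p * rangeSum 1 (p ℕ.+ 1 ∸ m) (G p)) ⟩
    Σ (suc n ∸ m) (λ j → sign (m ℕ.+ j) * rangeSum 1 (m ℕ.+ j ℕ.+ 1 ∸ m) (G (m ℕ.+ j)))
      ≈⟨ Σ-cong (suc n ∸ m) (λ j j<n → *-congˡ (inner j j<n)) ⟩
    Σ (suc n ∸ m) (λ j → F (m ℕ.+ j))
      ≈⟨ Σ-drop m≤1+n (λ p p<m → trans (*-congˡ (Σ-zero L λ i _ → G≈0 p i (ℕ.≤-<-trans p<m (ℕ.m<m+n m (s≤s z≤n))))) (zeroʳ _)) ⟩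
    Σ (suc n) F
      ≈⟨ Σ-cong′ (suc n) (λ p → Σ-distribˡ L (sign p) _) ⟩
    Σ (suc n) (λ p → Σ L (λ i → sign p * G p (suc i)))
      ≈⟨ Σ-comm (suc n) L _ ⟩
    Σ L (λ i → Σ (suc n) (λ p → sign p * G p (suc i)))
      ≈⟨ Σ-cong′ L (λ i → trans (Σ-cong′ (suc n) λ p →
           solve 5 (λ e σ b ω B → e :* (σ :* b :* ω :* B) := σ :* ω :* (e :* b :* B)) refl (sign p) (σ (suc i)) (b p (suc i)) (ω (suc i)) (B p (suc i)))
           (sym (Σ-distribˡ (suc n) _ _))) ⟩
    Σ L (λ i → σ (suc i) * ω (suc i) * Σ (suc n) (λ p → sign p * b p (suc i) * B p (suc i))) ∎
    where
    G : ℕ → ℕ → Carrier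
    G p i = σ i * b p i * ω i * B p i

    F : ℕ → Carrier
    F p = sign p * Σ L (λ i → G p (suc i))

    G≈0 : ∀ p i → suc p ℕ.< m ℕ.+ suc i → G p (suc i) ≈ 0#
    G≈0 p i p<m+i = trans (*-congʳ (trans (*-congʳ (trans (*-congˡ (b≈0 p (suc i) p<m+i)) (zeroʳ _))) (zeroˡ _))) (zeroˡ _)

    length≡ : ∀ j → m ℕ.+ j ℕ.+ 1 ∸ m ≡ suc j
    length≡ j = ≡.trans (≡.cong (_∸ m) (ℕ.+-assoc m j 1)) (≡.trans (ℕ.m+n∸m≡n m (j ℕ.+ 1)) (ℕ.+-comm j 1))

    inner : ∀ j → j ℕ.< suc n ∸ m → rangeSum 1 (m ℕ.+ j ℕ.+ 1 ∸ m) (G (m ℕ.+ j)) ≈ Σ L (λ i → G (m ℕ.+ j) (suc i))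
    inner j j<n = begin
      rangeSum 1 (m ℕ.+ j ℕ.+ 1 ∸ m) (G (m ℕ.+ j))              ≈⟨ rangeSum≈Σ 1 (m ℕ.+ j ℕ.+ 1 ∸ m) (G (m ℕ.+ j)) ⟩
      Σ (m ℕ.+ j ℕ.+ 1 ∸ m) (λ i → G (m ℕ.+ j) (suc i))         ≡⟨ ≡.cong (λ k → Σ k (λ i → G (m ℕ.+ j) (suc i))) (length≡ j) ⟩
      Σ (suc j) (λ i → G (m ℕ.+ j) (suc i))                    ≈⟨ Σ-extend (ℕ.≤-trans j<n 1+n∸m≤L) (λ i j<i → G≈0 (m ℕ.+ j) i
                                                                     (≡.subst (ℕ._< m ℕ.+ suc i) (ℕ.+-suc m j) (ℕ.+-monoʳ-< m (s≤s j<i)))) ⟩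
      Σ L (λ i → G (m ℕ.+ j) (suc i))                          ∎

  -- The series h, ψ and W, and the evaluation at W.

  module _ {n} (s : Carrier) (x : Vector Carrier n) (x#0 : ∀ a → x a # 0#) where

    -- (1 - e^{t xₐ}) / t, whose constant term -xₐ is apart from zero.
    shifted : Fin n → Series
    shifted a k = coeff 1-exp[t x a ] (k ℕ.+ 1)

    -- h a is t / (1 - e^{t xₐ}).
    h : Vector Series n
    h a = reciprocal (shifted a) (recip (shifted a 0) (Leading.lead#0 (leading-1-exp (x a) (x#0 a))))

    shifted*h : ∀ a → shifted a S.* h a ≋ S.1#
    shifted*h a = reciprocal-inverse (shifted a) _ (recip-inverseʳ _ _)

    coeff-1-exp*h : ∀ a → coeff 1-exp[t x a ] S.* h a ≋ T
    coeff-1-exp*h a = S.trans (S.*-congʳ (factor-T^ 1 _ (Leading.below (leading-1-exp (x a) (x#0 a)))))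
      (S.trans (S.*-assoc _ _ _) (S.trans (S.*-congˡ (shifted*h a)) (S.trans (S.*-identityʳ _) (S.*-identityʳ T))))

    coeff-1-exp : ∀ y → coeff 1-exp[t y ] ≋ S.1# S.- exp y
    coeff-1-exp y = pointwise λ { zero → refl ; (suc k) → refl }

    -- The value -1/xₐ. It is both hₐ(0) and t / (-t xₐ), which is where the B side and the V side
    -- meet.
    residue : Vector Carrier n
    residue a = h a 0

    -x*residue : ∀ a → (- x a) * residue a ≈ 1#
    -x*residue a = trans (*-congʳ (sym (trans (+-identityˡ _) (-‿cong (exp-at-1 (x a))))))
      (recip-inverseʳ _ _)

    coeff-[t]*residue : ∀ a → coeff -[t x a ] S.* const (residue a) ≋ T
    coeff-[t]*residue a = S.trans (S.*-comm _ _) (pointwise λ k → trans (const-⊛ (residue a) (coeff -[t x a ]) k) (value k))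
      where
      value : ∀ k → residue a * coeff -[t x a ] k ≈ T k
      value zero          = zeroʳ _
      value (suc zero)    = trans (*-comm _ _) (-x*residue a)
      value (suc (suc k)) = zeroʳ _

    module Reflect = RingMorphisms.IsRingHomomorphism reflect-isHom

    reflect-h : ∀ a → reflect (h a) ≋ h a S.- T
    reflect-h a = T-cancel (reflected-quotient (exp-neg (x a))
      (S.trans (S.*-congʳ (S.sym (coeff-1-exp (x a)))) (coeff-1-exp*h a))
      (S.trans (S.*-congʳ (S.sym reflect-d)) (S.trans (S.sym (Reflect.*-homo (coeff 1-exp[t x a ]) (h a)))
        (S.trans (Reflect.⟦⟧-cong (coeff-1-exp*h a)) reflect-T))))
      where
      reflect-d : reflect (coeff 1-exp[t x a ]) ≋ S.1# S.- exp (- x a)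
      reflect-d = S.trans (Reflect.⟦⟧-cong (coeff-1-exp (x a))) (S.trans (Reflect.+-homo S.1# (S.- exp (x a)))
        (S.+-cong Reflect.1#-homo (S.trans (Reflect.-‿homo (exp (x a))) (S.-‿cong (reflect-exp (x a))))))

    CTB≈ : ∀ p y → CTB x x#0 p y ≈ (exp y S.* S.esym h p) p
    CTB≈ = constantTerm-subsets (λ a → 1-exp[t x a ]) (λ _ → ≡.refl) (λ a → leading-1-exp (x a) (x#0 a)) (λ _ → ≡.refl)
      h coeff-1-exp*h

    CTV≈ : ∀ p y → CTV x x#0 p y ≈ y ^ p * 1/ p ! * esym residue p
    CTV≈ p y = begin
      CTV x x#0 p y
        ≈⟨ constantTerm-subsets (λ a → -[t x a ]) (λ _ → ≡.refl) (λ a → leading-monomial (x a) (x#0 a)) (λ _ → ≡.refl)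
             (λ a → const (residue a)) coeff-[t]*residue p y ⟩
      (exp y S.* S.esym (const ∘ residue) p) p
        ≈⟨ at (S.trans (S.*-congˡ (S.sym (Const.esym-homo residue p))) (S.*-comm _ _)) p ⟩
      (const (esym residue p) S.* exp y) p
        ≈⟨ trans (const-⊛ (esym residue p) (exp y) p) (*-comm _ _) ⟩
      y ^ p * 1/ p ! * esym residue p ∎

    -- The derivative in s of s ∏ₐ (1 + s / xₐ). In `left-side`, (p + 1)! turns the sᵖ / p! of `CTV`
    -- into (p + 1) sᵖ.
    Q : Carrier
    Q = Σ (suc n) (λ p → sign p * (suc p × 1#) * s ^ p * esym residue p)

    left-side : ∑[ 0 ≤ p ≤ n ] ((- 1#) ^ (n ∸ p) * (((p ℕ.+ 1) !) × CTV x x#0 p s)) ≈ sign n * Q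
    left-side = trans (rangeSum≈Σ 0 n _) (trans (Σ-cong (suc n) (λ p p≤n → term p (ℕ.s≤s⁻¹ p≤n))) (sym (Σ-distribˡ (suc n) (sign n) _)))
      where
      term : ∀ p → p ℕ.≤ n → sign (n ∸ p) * (((p ℕ.+ 1) !) × CTV x x#0 p s) ≈ sign n * (sign p * (suc p × 1#) * s ^ p * esym residue p)
      term p p≤n = begin
        sign (n ∸ p) * (((p ℕ.+ 1) !) × CTV x x#0 p s)
          ≈⟨ *-cong (trans (sign-∸ p≤n) (sign-+ n p)) (trans (×≈×1* ((p ℕ.+ 1) !) _) (*-cong factorial (CTV≈ p s))) ⟩
        sign n * sign p * ((suc p × 1#) * ((p !) × 1#) * (s ^ p * 1/ p ! * e))
          ≈⟨ solve 7 (λ a b k f y g e → a :* b :* (k :* f :* (y :* g :* e)) := a :* (b :* k :* y :* e) :* (f :* g))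
               refl (sign n) (sign p) (suc p × 1#) ((p !) × 1#) (s ^ p) (1/ p !) e ⟩
        sign n * (sign p * (suc p × 1#) * s ^ p * e) * (((p !) × 1#) * 1/ p !)
          ≈⟨ trans (*-congˡ (factorial-inverse p)) (*-identityʳ _) ⟩
        sign n * (sign p * (suc p × 1#) * s ^ p * e) ∎
        where
        e : Carrier
        e = esym residue p

        factorial : ((p ℕ.+ 1) !) × 1# ≈ (suc p × 1#) * ((p !) × 1#)
        factorial = trans (×-congˡ (≡.cong _! (ℕ.+-comm p 1))) (×1-homo-* (suc p) (p !))

    ψ : ℕ → Series
    ψ = S.coefficient T h

    reflect-ψ : ∀ i j → i ℕ.+ j ≡ suc n → reflect (ψ i) ≋ ψ j
    reflect-ψ = S.coefficient-palindrome reflect-isHom reflect-T h reflect-h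

    ψ-vanish : ∀ {j} → suc n ℕ.< j → ψ j ≋ S.0#
    ψ-vanish = S.coefficient-vanish T h

    signedChoose≈ : ∀ j p → S.signedChoose j p ≋ const (signedChoose j p)
    signedChoose≈ j p = S.sym (S.trans (RingMorphisms.IsRingHomomorphism.*-homo const-isHom _ _)
      (S.*-cong (Const.sign-homo p) (Const.×1-homo (suc p C j))))

    -- The factor tⁿ⁻ᵖ inside `ψ` moves `CTB`, a coefficient of tᵖ, to tⁿ, so that a single
    -- coefficient of one series collects all p.
    ψ-CTB : ∀ j y → (exp y S.* ψ j) n ≈ Σ (suc n) (λ p → sign p * ((suc p C j) × 1#) * CTB x x#0 p y)
    ψ-CTB j y = trans (at (S.Σ-distribˡ (suc n) (exp y) _) n) (trans (Σ-at (suc n) _ n)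
      (Σ-cong (suc n) λ p p<1+n → term p (ℕ.s≤s⁻¹ p<1+n)))
      where
      rearrange : ∀ a c t e → a S.* (c S.* (t S.* e)) ≋ c S.* (t S.* (a S.* e))
      rearrange = solveˢ 4 (λ a c t e → a :⊛ (c :⊛ (t :⊛ e)) :≋ c :⊛ (t :⊛ (a :⊛ e))) S.refl

      term : ∀ p → p ℕ.≤ n → (exp y S.* (S.signedChoose j p S.* ((T S.^ (n ∸ p)) S.* S.esym h p))) n ≈ signedChoose j p * CTB x x#0 p y
      term p p≤n = begin
        (exp y S.* (S.signedChoose j p S.* ((T S.^ (n ∸ p)) S.* S.esym h p))) n
          ≈⟨ at (S.trans (rearrange (exp y) (S.signedChoose j p) (T S.^ (n ∸ p)) (S.esym h p)) (S.*-congʳ (signedChoose≈ j p))) n ⟩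
        (const (signedChoose j p) S.* ((T S.^ (n ∸ p)) S.* (exp y S.* S.esym h p))) n
          ≈⟨ const-⊛ (signedChoose j p) _ n ⟩
        signedChoose j p * ((T S.^ (n ∸ p)) S.* (exp y S.* S.esym h p)) n
          ≡⟨ ≡.cong (λ k → signedChoose j p * ((T S.^ (n ∸ p)) S.* (exp y S.* S.esym h p)) k) (ℕ.m∸n+n≡m p≤n) ⟨
        signedChoose j p * ((T S.^ (n ∸ p)) S.* (exp y S.* S.esym h p)) (n ∸ p ℕ.+ p)
          ≈⟨ *-congˡ (trans (T^*-at (n ∸ p) (exp y S.* S.esym h p) p) (sym (CTB≈ p y))) ⟩
        signedChoose j p * CTB x x#0 p y ∎

    -- `r` is (1 - exp(-st)) / t, so r(0) = s; the powers of s on the left-hand side come from it.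
    W r : Series
    W = S.- exp (- s)
    r k = (S.1# S.+ W) (k ℕ.+ 1)

    1+W≋Tr : S.1# S.+ W ≋ T S.* r
    1+W≋Tr = S.trans (factor-T^ 1 (S.1# S.+ W) (λ { (s≤s z≤n) → trans (+-congˡ (-‿cong (exp-at-0 (- s)))) (-‿inverseʳ 1#) }))
      (S.*-congʳ (S.*-identityʳ T))

    r-at-0 : r 0 ≈ s
    r-at-0 = trans (+-identityˡ _) (trans (-‿cong (exp-at-1 (- s))) (-‿involutive s))

    W-at-0 : W 0 ≈ - 1#
    W-at-0 = -‿cong (exp-at-0 (- s))

    -- By `Σ-coefficient-j^` the sum is tⁿ X, so X(0) is wanted. There the part with `b` still
    -- carries a factor t and vanishes, while W(0) = -1, r(0) = s and hₐ(0) = -1/xₐ turn the part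
    -- with `a` into -a(0) `Q`.
    evaluate : ∀ a b → S.Σ (suc (suc n)) (λ j → (a S.* ((j S.× S.1#) S.* (W S.^ j)) S.+ b S.* (W S.^ j)) S.* ψ j) n ≈ - (a 0 * Q)
    evaluate a b = begin
      S.Σ (suc (suc n)) (λ j → (a S.* ((j S.× S.1#) S.* (W S.^ j)) S.+ b S.* (W S.^ j)) S.* ψ j) n
        ≈⟨ at (S.Σ-coefficient-j^ T h 1+W≋Tr a b) n ⟩
      ((T S.^ n) S.* X) n
        ≡⟨ ≡.cong ((T S.^ n) S.* X) (ℕ.+-identityʳ n) ⟨
      ((T S.^ n) S.* X) (n ℕ.+ 0)
        ≈⟨ T^*-at n X 0 ⟩
      (a S.* (W S.* Qˢ)) 0 + (T S.* (b S.* Q′)) 0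
        ≈⟨ +-cong (trans (⊛-at-0 a (W S.* Qˢ)) (*-congˡ (trans (⊛-at-0 W Qˢ) (*-cong W-at-0 Qˢ-at-0)))) (T*-0 (b S.* Q′)) ⟩
      a 0 * (- 1# * Q) + 0#
        ≈⟨ solve 2 (λ a q → a :* (:- con 1ℤ :* q) :+ con 0ℤ := :- (a :* q)) refl (a 0) Q ⟩
      - (a 0 * Q) ∎
      where
      Qˢ Q′ X : Series
      Qˢ = S.Σ (suc n) (λ p → S.sign p S.* (suc p S.× S.1#) S.* (r S.^ p) S.* S.esym h p)
      Q′ = S.Σ (suc n) (λ p → S.sign p S.* (r S.^ suc p) S.* S.esym h p)
      X = a S.* (W S.* Qˢ) S.+ T S.* (b S.* Q′)

      Qˢ-at-0 : Qˢ 0 ≈ Q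
      Qˢ-at-0 = trans (Evaluation.Σ-homo (suc n) _) (Σ-cong′ (suc n) λ p →
        trans (⊛-at-0 _ _) (*-cong (trans (⊛-at-0 _ _) (*-cong (trans (⊛-at-0 _ _)
          (*-cong (Evaluation.sign-homo p) (Evaluation.×1-homo (suc p))))
          (trans (Evaluation.^-homo r p) (^-congˡ p r-at-0)))) (Evaluation.esym-homo h p)))

    -- (j - m) e^{mst} Wʲ
    weight : ℕ → ℕ → Series
    weight m j = exp (m × s) S.* ((j S.× S.1#) S.* (W S.^ j)) S.+ (S.- (m S.× S.1#) S.* exp (m × s)) S.* (W S.^ j)

    W^≋ : ∀ j → W S.^ j ≋ S.sign j S.* exp (j × (- s))
    W^≋ j = S.trans (S.^-congˡ j (solveˢ 1 (λ e → :⊖ e :≋ :⊖ conˢ 1ℤ :⊛ e) S.refl (exp (- s))))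
      (S.trans (S.^-distrib-* (S.- S.1#) (exp (- s)) j) (S.*-congˡ (exp-^ (- s) j)))

    weight≋ : ∀ m j → weight m j ≋ const (sign j * (j × 1# - m × 1#)) S.* exp (exponent s m j)
    weight≋ m j = S.trans (S.+-cong (S.*-congˡ (S.*-congˡ (W^≋ j))) (S.*-congˡ (W^≋ j)))
      (S.trans (solveˢ 5 (λ e J M σ e′ → e :⊛ (J :⊛ (σ :⊛ e′)) :⊕ (:⊖ M :⊛ e) :⊛ (σ :⊛ e′)
                  :≋ (σ :⊛ (J :⊝ M)) :⊛ (e :⊛ e′)) S.refl (exp (m × s)) (j S.× S.1#) (m S.× S.1#) (S.sign j) (exp (j × (- s))))
        (S.*-cong (S.sym constant) (S.sym (exp-+ (m × s) (j × (- s))))))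
      where
      open RingMorphisms.IsRingHomomorphism const-isHom
      constant : const (sign j * (j × 1# - m × 1#)) ≋ S.sign j S.* ((j S.× S.1#) S.- (m S.× S.1#))
      constant = S.trans (*-homo (sign j) _) (S.*-cong (Const.sign-homo j)
        (S.trans (+-homo _ _) (S.+-cong (Const.×1-homo j) (S.trans (-‿homo _) (S.-‿cong (Const.×1-homo m))))))

    fold-series : ∀ m (χ : ℕ → Series) → (∀ i j y → i ℕ.+ j ≡ m ℕ.+ m → (exp y S.* χ i) n ≈ - ((exp (- y) S.* χ j) n)) →
      2 × Σ m (λ i → sign (m ∸ suc i) * (suc i × 1#) * (exp (- (suc i × s)) S.* χ (m ℕ.+ suc i)) n) ≈
      S.Σ (suc (m ℕ.+ m)) (λ j → weight m j S.* χ j) n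
    fold-series m χ odd = begin
      2 × Σ m (λ i → sign (m ∸ suc i) * (suc i × 1#) * (exp (- (suc i × s)) S.* χ (m ℕ.+ suc i)) n)
        ≈⟨ fold s m (λ j y → (exp y S.* χ j) n) (λ j y≈z → at (S.*-congʳ (exp-cong y≈z)) n) odd ⟨
      Σ (suc (m ℕ.+ m)) (λ j → sign j * (j × 1# - m × 1#) * (exp (exponent s m j) S.* χ j) n)
        ≈⟨ Σ-cong′ (suc (m ℕ.+ m)) (λ j → trans (sym (const-⊛ _ _ n))
             (at (S.trans (S.sym (S.*-assoc _ _ _)) (S.*-congʳ (S.sym (weight≋ m j)))) n)) ⟩
      Σ (suc (m ℕ.+ m)) (λ j → (weight m j S.* χ j) n)
        ≈⟨ Σ-at (suc (m ℕ.+ m)) _ n ⟨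
      S.Σ (suc (m ℕ.+ m)) (λ j → weight m j S.* χ j) n ∎

    reflect-exp* : ∀ y {f g} → reflect f ≋ g → sign n * (exp y S.* f) n ≈ (exp (- y) S.* g) n
    reflect-exp* y {f} p = at (S.trans (*-homo (exp y) f) (S.*-cong (reflect-exp y) p)) n
      where open RingMorphisms.IsRingHomomorphism reflect-isHom using (*-homo)

    odd-case : ∀ m → n ℕ.+ 1 ≡ 2 ℕ.* m →
      ∑[ 0 ≤ p ≤ n ] ((- 1#) ^ (n ∸ p) * (((p ℕ.+ 1) !) × CTV x x#0 p s))
      ≈ ∑[ m ≤ p ≤ n ] ((- 1#) ^ p *
          ∑[ 1 ≤ i ≤ p ℕ.+ 1 ∸ m ] ((- 1#) ^ (m ∸ i) * (((p ℕ.+ 1) C (m ℕ.+ i)) × 1#) * ((2 ℕ.* i) × 1#) * CTB x x#0 p (- (i × s))))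
    odd-case m n+1≡2m = begin
      ∑[ 0 ≤ p ≤ n ] ((- 1#) ^ (n ∸ p) * (((p ℕ.+ 1) !) × CTV x x#0 p s))
        ≈⟨ left-side ⟩
      sign n * Q
        -- As n is odd, `sign n` is the minus sign of `evaluate`, and the inserted e^{mst} has value
        -- 1 at t = 0. With b = -m e^{mst} the summand of `evaluate` is `weight m j` by definition.
        ≈⟨ trans (*-congʳ sign-n) (trans (-1*x≈-x Q) (-‿cong (sym (trans (*-congʳ (exp-at-0 (m × s))) (*-identityˡ Q))))) ⟩
      - (exp (m × s) 0 * Q)
        ≈⟨ evaluate (exp (m × s)) (S.- (m S.× S.1#) S.* exp (m × s)) ⟨
      S.Σ (suc (suc n)) (λ j → weight m j S.* ψ j) n
        ≡⟨ ≡.cong (λ k → S.Σ (suc k) (λ j → weight m j S.* ψ j) n) 1+n≡m+m ⟩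
      S.Σ (suc (m ℕ.+ m)) (λ j → weight m j S.* ψ j) n
        ≈⟨ fold-series m ψ antisymmetric ⟨
      2 × Σ m (λ i → sign (m ∸ suc i) * (suc i × 1#) * (exp (- (suc i × s)) S.* ψ (m ℕ.+ suc i)) n)
        ≈⟨ trans (×≈×1* 2 _) (Σ-distribˡ m (2 × 1#) _) ⟩
      Σ m (λ i → (2 × 1#) * (sign (m ∸ suc i) * (suc i × 1#) * (exp (- (suc i × s)) S.* ψ (m ℕ.+ suc i)) n))
        ≈⟨ Σ-cong′ m (λ i → trans (solve 4 (λ t σ k a → t :* (σ :* k :* a) := σ :* (t :* k) :* a) refl (2 × 1#) (sign (m ∸ suc i)) (suc i × 1#) _)
             (*-cong (*-congˡ (sym (×1-homo-* 2 (suc i)))) (trans (ψ-CTB (m ℕ.+ suc i) (- (suc i × s)))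
               (Σ-cong′ (suc n) λ p → *-congʳ (*-congˡ (×-congˡ (≡.cong (_C (m ℕ.+ suc i)) (ℕ.+-comm 1 p)))))))) ⟩
      Σ m (λ i → sign (m ∸ suc i) * ((2 ℕ.* suc i) × 1#) *
        Σ (suc n) (λ p → sign p * (((p ℕ.+ 1) C (m ℕ.+ suc i)) × 1#) * CTB x x#0 p (- (suc i × s))))
        ≈⟨ regroup m n m (λ i → sign (m ∸ i)) (λ i → (2 ℕ.* i) × 1#) (λ p i → ((p ℕ.+ 1) C (m ℕ.+ i)) × 1#) (λ p i → CTB x x#0 p (- (i × s)))
             m≤1+n 1+n∸m≤m (λ p i p<m+i → C-vanish (≡.subst (ℕ._< m ℕ.+ i) (ℕ.+-comm 1 p) p<m+i)) ⟨
      _ ∎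
      where
      1+n≡m+m : suc n ≡ m ℕ.+ m
      1+n≡m+m = ≡.trans (ℕ.+-comm 1 n) (≡.trans n+1≡2m (≡.cong (m ℕ.+_) (ℕ.+-identityʳ m)))

      m≤1+n : m ℕ.≤ suc n
      m≤1+n = ≡.subst (m ℕ.≤_) (≡.sym 1+n≡m+m) (ℕ.m≤m+n m m)

      1+n∸m≤m : suc n ∸ m ℕ.≤ m
      1+n∸m≤m = ℕ.≤-reflexive (≡.trans (≡.cong (_∸ m) 1+n≡m+m) (ℕ.m+n∸m≡n m m))

      sign-n : sign n ≈ - 1#
      sign-n = begin
        sign n              ≈⟨ solve 1 (λ a → a := :- (:- con 1ℤ :* a)) refl (sign n) ⟩
        - sign (suc n)      ≈⟨ -‿cong (trans (reflexive (≡.cong sign 1+n≡m+m)) (sign-even m)) ⟩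
        - 1#                ∎

      antisymmetric : ∀ i j y → i ℕ.+ j ≡ m ℕ.+ m → (exp y S.* ψ i) n ≈ - ((exp (- y) S.* ψ j) n)
      antisymmetric i j y i+j≡2m = begin
        (exp y S.* ψ i) n                 ≈⟨ solve 1 (λ a → a := :- (:- con 1ℤ :* a)) refl _ ⟩
        - (- 1# * (exp y S.* ψ i) n)      ≈⟨ -‿cong (*-congʳ sign-n) ⟨
        - (sign n * (exp y S.* ψ i) n)    ≈⟨ -‿cong (reflect-exp* y (reflect-ψ i j (≡.trans i+j≡2m (≡.sym 1+n≡m+m)))) ⟩
        - ((exp (- y) S.* ψ j) n)         ∎

    -- Reversing the coefficients of z - 1 negates it, so its product with the palindromic
    -- polynomial of degree n + 1 is antipalindromic of degree n + 2. At the two ends one of the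
    -- subtracted coefficients lies outside the range and is zero.
    reflect-difference : ∀ i j → i ℕ.+ j ≡ suc (suc n) → reflect (difference ψ i) ≋ S.- difference ψ j
    reflect-difference zero .(suc (suc n)) ≡.refl = S.trans (-‿homo (ψ 0)) (S.-‿cong (S.trans (reflect-ψ 0 (suc n) ≡.refl)
      (S.sym (S.trans (S.+-congˡ (S.trans (S.-‿cong (ψ-vanish ℕ.≤-refl)) S.-0#≈0#)) (S.+-identityʳ _)))))
      where open RingMorphisms.IsRingHomomorphism reflect-isHom
    reflect-difference (suc i) zero eq = S.trans (+-homo (ψ i) (S.- ψ (suc i)))
      (S.trans (S.+-cong (reflect-ψ i 0 i+0≡1+n) (S.trans (-‿homo (ψ (suc i))) (S.-‿cong (S.trans
          (⟦⟧-cong (ψ-vanish (s≤s (ℕ.≤-reflexive (≡.sym (≡.trans (≡.sym (ℕ.+-identityʳ i)) i+0≡1+n)))))) 0#-homo))))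
        (solveˢ 1 (λ a → a :⊝ conˢ 0ℤ :≋ :⊖ (:⊖ a)) S.refl (ψ 0)))
      where
      open RingMorphisms.IsRingHomomorphism reflect-isHom
      i+0≡1+n : i ℕ.+ 0 ≡ suc n
      i+0≡1+n = ℕ.suc-injective eq
    reflect-difference (suc i) (suc j) eq = S.trans (+-homo (ψ i) (S.- ψ (suc i)))
      (S.trans (S.+-cong (reflect-ψ i (suc j) (ℕ.suc-injective eq))
          (S.trans (-‿homo (ψ (suc i))) (S.-‿cong (reflect-ψ (suc i) j (≡.trans (≡.sym (ℕ.+-suc i j)) (ℕ.suc-injective eq))))))
        (solveˢ 2 (λ a b → a :⊝ b :≋ :⊖ (b :⊝ a)) S.refl (ψ (suc j)) (ψ j)))
      where open RingMorphisms.IsRingHomomorphism reflect-isHom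

    -- The even identity has no 2 on its right-hand side to absorb the one produced by folding, so
    -- both sides are doubled first; characteristic zero undoes this.
    ×2-cancel : ∀ {a b} → 2 × a ≈ 2 × b → a ≈ b
    ×2-cancel {a} {b} 2a≈2b = begin
      a                    ≈⟨ halve a ⟨
      half * (2 × a)       ≈⟨ *-congˡ 2a≈2b ⟩
      half * (2 × b)       ≈⟨ halve b ⟩
      b                    ∎
      where
      half : Carrier
      half = recip (2 × 1#) (char0 2)

      halve : ∀ a → half * (2 × a) ≈ a
      halve a = trans (*-congˡ (×≈×1* 2 a)) (trans (sym (*-assoc _ _ _))
        (trans (*-congʳ (trans (*-comm _ _) (recip-inverseʳ _ _))) (*-identityˡ a)))

    -- `Σ-difference` replaces the weight by its increment in j; this brings the increment into the
    -- form a j Wʲ + b Wʲ that `evaluate` accepts, with a = e^{mst} (W - 1).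
    weight-difference : ∀ m j → weight m (suc j) S.- weight m j ≋
      exp (m × s) S.* (W S.- S.1#) S.* ((j S.× S.1#) S.* (W S.^ j)) S.+
      (exp (m × s) S.* W S.+ (S.- (m S.× S.1#) S.* exp (m × s)) S.* (W S.- S.1#)) S.* (W S.^ j)
    weight-difference m j = solveˢ 5 (λ e J M w v →
      e :⊛ ((conˢ 1ℤ :⊕ J) :⊛ (w :⊛ v)) :⊕ (:⊖ M :⊛ e) :⊛ (w :⊛ v)
        :⊝ (e :⊛ (J :⊛ v) :⊕ (:⊖ M :⊛ e) :⊛ v)
      :≋ e :⊛ (w :⊝ conˢ 1ℤ) :⊛ (J :⊛ v) :⊕
        (e :⊛ w :⊕ (:⊖ M :⊛ e) :⊛ (w :⊝ conˢ 1ℤ)) :⊛ v)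
      S.refl (exp (m × s)) (j S.× S.1#) (m S.× S.1#) W (W S.^ j)

    even-case : ∀ m → n ≡ 2 ℕ.* m →
      ∑[ 0 ≤ p ≤ n ] ((- 1#) ^ (n ∸ p) * (((p ℕ.+ 1) !) × CTV x x#0 p s))
      ≈ ∑[ m ≤ p ≤ n ] ((- 1#) ^ p *
          ∑[ 1 ≤ i ≤ p ℕ.+ 1 ∸ m ] ((- 1#) ^ (m ℕ.+ 1 ∸ i) * (((p ℕ.+ 1) C (m ℕ.+ i)) × 1# - ((p ℕ.+ 1) C (m ℕ.+ i ℕ.+ 1)) × 1#) * (i × 1#) * CTB x x#0 p (- (i × s))))
    even-case m n≡2m = trans (left-side) (trans (*-congʳ sign-n) (trans (*-identityˡ Q) (×2-cancel (begin
      2 × Q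
        ≈⟨ solve 1 (λ q → q :+ (q :+ con 0ℤ) := :- (con 1ℤ :* (:- con 1ℤ :+ :- con 1ℤ) :* q)) refl Q ⟩
      - (1# * (- 1# - 1#) * Q)
        -- At t = 0 the new `a` is 1 · (-1 - 1) = -2, which accounts for the doubled left-hand side.
        ≈⟨ -‿cong (*-congʳ (trans (⊛-at-0 E (W S.- S.1#)) (*-cong (exp-at-0 (M × s)) (+-congʳ (W-at-0))))) ⟨
      - ((E S.* (W S.- S.1#)) 0 * Q)
        ≈⟨ evaluate (E S.* (W S.- S.1#)) (E S.* W S.+ (S.- (M S.× S.1#) S.* E) S.* (W S.- S.1#)) ⟨
      S.Σ (2 ℕ.+ n) (λ j → (E S.* (W S.- S.1#) S.* ((j S.× S.1#) S.* (W S.^ j)) S.+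
        (E S.* W S.+ (S.- (M S.× S.1#) S.* E) S.* (W S.- S.1#)) S.* (W S.^ j)) S.* ψ j) n
        ≈⟨ at (S.trans (Σ-difference (2 ℕ.+ n) (weight M) ψ (ψ-vanish ℕ.≤-refl))
             (S.Σ-cong′ (2 ℕ.+ n) λ j → S.*-congʳ (weight-difference M j))) n ⟨
      S.Σ (3 ℕ.+ n) (λ j → weight M j S.* difference ψ j) n
        ≡⟨ ≡.cong (λ k → S.Σ (suc k) (λ j → weight M j S.* difference ψ j) n) 2+n≡M+M ⟩
      S.Σ (suc (M ℕ.+ M)) (λ j → weight M j S.* difference ψ j) n
        ≈⟨ fold-series M (difference ψ) antisymmetric ⟨
      2 × Σ M (λ i → sign (M ∸ suc i) * (suc i × 1#) * (exp (- (suc i × s)) S.* difference ψ (M ℕ.+ suc i)) n)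
        ≈⟨ ×-congʳ 2 (Σ-cong′ M λ i → *-cong (*-congʳ (reflexive (≡.cong (λ k → sign (k ∸ suc i)) (ℕ.+-comm 1 m)))) (constant-term i)) ⟩
      2 × Σ M (λ i → sign (m ℕ.+ 1 ∸ suc i) * (suc i × 1#) *
        Σ (suc n) (λ p → sign p * b p (suc i) * CTB x x#0 p (- (suc i × s))))
        ≈⟨ ×-congʳ 2 (regroup m n M (λ i → sign (m ℕ.+ 1 ∸ i)) (λ i → i × 1#) b (λ p i → CTB x x#0 p (- (i × s)))
             m≤1+n 1+n∸m≤M b-vanish) ⟨
      _ ∎))))
      where
      M : ℕ
      M = suc m

      E : Series
      E = exp (M × s)

      b : ℕ → ℕ → Carrier
      b p i = ((p ℕ.+ 1) C (m ℕ.+ i)) × 1# - ((p ℕ.+ 1) C (m ℕ.+ i ℕ.+ 1)) × 1#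

      n≡m+m : n ≡ m ℕ.+ m
      n≡m+m = ≡.trans n≡2m (≡.cong (m ℕ.+_) (ℕ.+-identityʳ m))

      2+n≡M+M : 2 ℕ.+ n ≡ M ℕ.+ M
      2+n≡M+M = ≡.cong suc (≡.trans (≡.cong suc n≡m+m) (≡.sym (ℕ.+-suc m m)))

      m≤1+n : m ℕ.≤ suc n
      m≤1+n = ℕ.m≤n⇒m≤1+n (≡.subst (m ℕ.≤_) (≡.sym n≡m+m) (ℕ.m≤m+n m m))

      1+n∸m≤M : suc n ∸ m ℕ.≤ M
      1+n∸m≤M = ℕ.≤-reflexive (≡.trans (≡.cong (λ k → suc k ∸ m) n≡m+m) (≡.trans (≡.cong (_∸ m) (≡.sym (ℕ.+-suc m m))) (ℕ.m+n∸m≡n m M)))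

      b-vanish : ∀ p i → suc p ℕ.< m ℕ.+ i → b p i ≈ 0#
      b-vanish p i p<m+i = trans (+-cong (C-vanish p+1<m+i) (trans (-‿cong (C-vanish (ℕ.<-≤-trans p+1<m+i (ℕ.m≤m+n _ 1)))) -0#≈0#)) (+-identityˡ 0#)
        where
        p+1<m+i : p ℕ.+ 1 ℕ.< m ℕ.+ i
        p+1<m+i = ≡.subst (ℕ._< m ℕ.+ i) (ℕ.+-comm 1 p) p<m+i

      sign-n : sign n ≈ 1#
      sign-n = trans (reflexive (≡.cong sign n≡m+m)) (sign-even m)

      antisymmetric : ∀ i j y → i ℕ.+ j ≡ M ℕ.+ M → (exp y S.* difference ψ i) n ≈ - ((exp (- y) S.* difference ψ j) n)
      antisymmetric i j y i+j≡2M = begin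
        (exp y S.* difference ψ i) n              ≈⟨ trans (*-congʳ sign-n) (*-identityˡ _) ⟨
        sign n * (exp y S.* difference ψ i) n     ≈⟨ reflect-exp* y (reflect-difference i j (≡.trans i+j≡2M (≡.sym 2+n≡M+M))) ⟩
        (exp (- y) S.* (S.- difference ψ j)) n    ≈⟨ at (solveˢ 2 (λ e d → e :⊛ (:⊖ d) :≋ :⊖ (e :⊛ d)) S.refl (exp (- y)) (difference ψ j)) n ⟩
        - ((exp (- y) S.* difference ψ j) n)      ∎

      constant-term : ∀ i → (exp (- (suc i × s)) S.* difference ψ (M ℕ.+ suc i)) n ≈
                            Σ (suc n) (λ p → sign p * b p (suc i) * CTB x x#0 p (- (suc i × s)))
      constant-term i = begin
        -- `M + suc i` is `suc k` by definition, so `difference ψ` unfolds to ψ at k minus ψ at k +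
        -- 1, giving the binomials at m + i and m + i + 1 for the theorem's i, here `suc i`.
        (e S.* (ψ k S.- ψ (suc k))) n
          ≈⟨ at (solveˢ 3 (λ e a b → e :⊛ (a :⊝ b) :≋ e :⊛ a :⊝ e :⊛ b) S.refl e (ψ k) (ψ (suc k))) n ⟩
        (e S.* ψ k) n - (e S.* ψ (suc k)) n
          ≈⟨ +-cong (ψ-CTB k y) (trans (-‿cong (ψ-CTB (suc k) y)) (trans (sym (-1*x≈-x _)) (Σ-distribˡ (suc n) (- 1#) _))) ⟩
        Σ (suc n) (λ p → sign p * ((suc p C k) × 1#) * CTB x x#0 p y) + Σ (suc n) (λ p → - 1# * (sign p * ((suc p C suc k) × 1#) * CTB x x#0 p y))
          ≈⟨ Σ-distrib-+ (suc n) _ _ ⟨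
        Σ (suc n) (λ p → sign p * ((suc p C k) × 1#) * CTB x x#0 p y + - 1# * (sign p * ((suc p C suc k) × 1#) * CTB x x#0 p y))
          ≈⟨ Σ-cong′ (suc n) (λ p → trans
               (solve 4 (λ σ a b B → σ :* a :* B :+ :- con 1ℤ :* (σ :* b :* B) := σ :* (a :- b) :* B) refl (sign p) ((suc p C k) × 1#) ((suc p C suc k) × 1#) (CTB x x#0 p y))
               (*-congʳ (*-congˡ (+-cong (×-congˡ (≡.cong (_C k) (ℕ.+-comm 1 p))) (-‿cong (×-congˡ (≡.cong₂ _C_ (ℕ.+-comm 1 p) (ℕ.+-comm 1 k)))))))) ⟩
        Σ (suc n) (λ p → sign p * b p (suc i) * CTB x x#0 p y) ∎
        where
        y : Carrier
        y = - (suc i × s)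
        e : Series
        e = exp y
        k : ℕ
        k = m ℕ.+ suc i

theorem4p1 : ∀ {c ℓ₁ ℓ₂} (K : HeytingField c ℓ₁ ℓ₂) (char0 : CharacteristicZero K) →
    let open Series-in-t K char0 in
    ∀ (n : ℕ) .{{_ : NonZero n}} (s : Carrier) (x : Vector Carrier n) (x#0 : ∀ a → x a # 0#) →
    (∀ (m : ℕ) → n ℕ.+ 1 ≡ 2 ℕ.* m →
    ∑[ 0 ≤ p ≤ n ] ((- 1#) ^ (n ∸ p) * (((p ℕ.+ 1) !) × CTV x x#0 p s))
    ≈ ∑[ m ≤ p ≤ n ] ((- 1#) ^ p *
    ∑[ 1 ≤ i ≤ p ℕ.+ 1 ∸ m ] ((- 1#) ^ (m ∸ i) * (((p ℕ.+ 1) C (m ℕ.+ i)) × 1#) * ((2 ℕ.* i) × 1#) * CTB x x#0 p (- (i × s)))))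
    Product.×
    (∀ (m : ℕ) → n ≡ 2 ℕ.* m →
    ∑[ 0 ≤ p ≤ n ] ((- 1#) ^ (n ∸ p) * (((p ℕ.+ 1) !) × CTV x x#0 p s))
    ≈ ∑[ m ≤ p ≤ n ] ((- 1#) ^ p *
    ∑[ 1 ≤ i ≤ p ℕ.+ 1 ∸ m ] ((- 1#) ^ (m ℕ.+ 1 ∸ i) * (((p ℕ.+ 1) C (m ℕ.+ i)) × 1# - ((p ℕ.+ 1) C (m ℕ.+ i ℕ.+ 1)) × 1#) * (i × 1#) * CTB x x#0 p (- (i × s)))))
theorem4p1 K char0 n s x x#0 = odd-case s x x#0 Product., even-case s x x#0
  where open Identity K char0
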